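{- The freeness problem for braids from $B_5$ is undecidable: there is no algorithm which, given a finite set $B \subseteq B_5$ of braids, decides whether the semigroup $\langle B \rangle$ is free.
   Context: $B_5$ is the braid group on five strands, with generators $\sigma_1,\dots,\sigma_4$ and relations $\sigma_i\sigma_j = \sigma_j\sigma_i$ for $|i-j|\ge 2$ and $\sigma_i\sigma_{i+1}\sigma_i = \sigma_{i+1}\sigma_i\sigma_{i+1}$ for $1 \le i \le 3$; braids are given as words over the generators and their inverses. For a finite set $B$ of braids, $\langle B \rangle$ is the semigroup of all nonempty finite products of elements of $B$; it is free (on $B$) if any two different finite sequences of generators from $B$ yield different elements of $B_5$. -}

module Defs where

open import Data.Nat using (ℕ; zero; suc; _+_; _*_; _<_)
open import Data.Nat.Properties using (_≟_)
open import Data.Bool using (Bool; true; false)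
open import Data.Fin using (Fin; toℕ)
open import Data.Fin as F using ()
open import Data.List using (List; []; _∷_; _++_; length; lookup)
open import Data.List.NonEmpty using (List⁺; _∷_; toList)
open import Data.List.Relation.Binary.Pointwise using (Pointwise)
open import Data.Vec using (Vec; []; _∷_)
open import Data.Product using (Σ; ∃; _×_)
open import Relation.Nullary using (¬_)

-- A letter: a generator σᵢ (i ∈ Fin 4, meaning σ_{i+1}) with a sign;
-- true = σᵢ, false = σᵢ⁻¹.
Letter : Set
Letter = Fin 4 × Bool

open import Data.Product using (_,_)

BraidWord : Set
BraidWord = List Letter

FarApart : Fin 4 → Fin 4 → Set
FarApart i j = (suc (toℕ i) < toℕ j) Data.Sum.⊎ (suc (toℕ j) < toℕ i)
  where import Data.Sum

data Elementary : BraidWord → BraidWord → Set where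
  cancel   : ∀ i b → Elementary ((i , b) ∷ (i , Data.Bool.not b) ∷ []) []
  commute  : ∀ i j b c → FarApart i j →
             Elementary ((i , b) ∷ (j , c) ∷ []) ((j , c) ∷ (i , b) ∷ [])
  braid    : ∀ (i : Fin 3) →
             Elementary ((F.inject₁ i , true) ∷ (F.suc i , true) ∷ (F.inject₁ i , true) ∷ [])
                        ((F.suc i , true) ∷ (F.inject₁ i , true) ∷ (F.suc i , true) ∷ [])

infix 4 _≈B_
data _≈B_ : BraidWord → BraidWord → Set where
  step  : ∀ u v {l r} → Elementary l r → (u ++ l ++ v) ≈B (u ++ r ++ v)
  refl  : ∀ {w} → w ≈B w
  sym   : ∀ {w w′} → w ≈B w′ → w′ ≈B w
  trans : ∀ {w₁ w₂ w₃} → w₁ ≈B w₂ → w₂ ≈B w₃ → w₁ ≈B w₃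

prod : List BraidWord → BraidWord
prod [] = []
prod (w ∷ ws) = w ++ prod ws

evalSeq : (B : List BraidWord) → List⁺ (Fin (length B)) → BraidWord
evalSeq B s = prod (Data.List.map (lookup B) (toList s))

IsFree : List BraidWord → Set
IsFree B = ∀ (s t : List⁺ (Fin (length B))) →
  evalSeq B s ≈B evalSeq B t →
  Pointwise (λ i j → lookup B i ≈B lookup B j) (toList s) (toList t)

data PRF : ℕ → Set where
  zeroF : PRF 0
  succF : PRF 1
  projF : ∀ {n} → Fin n → PRF n
  compF : ∀ {m n} → PRF m → Vec (PRF n) m → PRF n
  recF  : ∀ {n} → PRF n → PRF (suc (suc n)) → PRF (suc n)
  muF   : ∀ {n} → PRF (suc n) → PRF n

mutual
  data _⟦_⟧⇓_ : ∀ {n} → PRF n → Vec ℕ n → ℕ → Set where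
    ev-zero : zeroF ⟦ [] ⟧⇓ 0
    ev-succ : ∀ {x} → succF ⟦ x ∷ [] ⟧⇓ suc x
    ev-proj : ∀ {n} {i : Fin n} {xs} → projF i ⟦ xs ⟧⇓ Data.Vec.lookup xs i
    ev-comp : ∀ {m n} {f : PRF m} {gs : Vec (PRF n) m} {xs ys y} →
              gs ⟦ xs ⟧⇓* ys → f ⟦ ys ⟧⇓ y → compF f gs ⟦ xs ⟧⇓ y
    ev-rec0 : ∀ {n} {f : PRF n} {g xs y} →
              f ⟦ xs ⟧⇓ y → recF f g ⟦ 0 ∷ xs ⟧⇓ y
    ev-recS : ∀ {n} {f : PRF n} {g xs k z y} →
              recF f g ⟦ k ∷ xs ⟧⇓ z → g ⟦ k ∷ z ∷ xs ⟧⇓ y →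
              recF f g ⟦ suc k ∷ xs ⟧⇓ y
    ev-mu   : ∀ {n} {f : PRF (suc n)} {xs y} →
              f ⟦ y ∷ xs ⟧⇓ 0 →
              (∀ z → z < y → ∃ λ k → f ⟦ z ∷ xs ⟧⇓ suc k) →
              muF f ⟦ xs ⟧⇓ y

  data _⟦_⟧⇓*_ : ∀ {m n} → Vec (PRF n) m → Vec ℕ n → Vec ℕ m → Set where
    []  : ∀ {n} {xs : Vec ℕ n} → [] ⟦ xs ⟧⇓* []
    _∷_ : ∀ {m n} {g : PRF n} {gs : Vec (PRF n) m} {xs y ys} →
          g ⟦ xs ⟧⇓ y → gs ⟦ xs ⟧⇓* ys → (g ∷ gs) ⟦ xs ⟧⇓* (y ∷ ys)

-- Cantor pairing
pair : ℕ → ℕ → ℕ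
pair a b = tri (a + b) + b
  where
  tri : ℕ → ℕ
  tri zero = 0
  tri (suc k) = suc k + tri k

encodeList : ∀ {A : Set} → (A → ℕ) → List A → ℕ
encodeList e [] = 0
encodeList e (x ∷ xs) = suc (pair (e x) (encodeList e xs))

encodeLetter : Letter → ℕ
encodeLetter (i , true)  = 2 * toℕ i
encodeLetter (i , false) = suc (2 * toℕ i)

encodeWord : BraidWord → ℕ
encodeWord = encodeList encodeLetter

encodeSet : List BraidWord → ℕ
encodeSet = encodeList encodeWord

DecidesFreeness : PRF 1 → Set
DecidesFreeness p = ∀ (B : List BraidWord) →
  (IsFree B → p ⟦ encodeSet B ∷ [] ⟧⇓ 1) × (¬ IsFree B → p ⟦ encodeSet B ∷ [] ⟧⇓ 0)

{-# OPTIONS --safe #-}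

-- In B₅ the elements σ₁⁻¹ and σ₂ commute with σ₄ and (σ₄σ₃σ₂σ₁σ₁σ₂σ₃σ₄)², and the Burau
-- representation at t = -1 maps the two pairs to free generators of monoids acting on complementary
-- planes.  So B₅ contains a product of two free monoids of rank 2, and freeness becomes a matching
-- problem for pairs of words.
--
-- A deterministic queue rewriting system gives such an instance: two elements (u , v with separators
-- before its letters) and (u , u with separators after its letters) for every rule u → v.  Two
-- products can only coincide when one runs ahead of the other by exactly the queue, so the instance
-- is free if the system gets stuck and not free if it accepts.  A recursive function p compiles to a
-- register program and then to a queue system, by forward simulation alone, since determinism
-- excludes acceptance when the run for p = 0 gets stuck.
--
-- Only one element depends on the input n, and the function completing the code of the other
-- elements to the code of the whole instance is primitive recursive.  Running p after this
-- completion on the code of the remaining elements makes the instance contradict the answer of p.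

module Submission where

open import Defs
open import Data.Bool using (Bool; true; false; not)
open import Data.Empty using (⊥-elim)
open import Data.Fin using (Fin; zero; suc; toℕ)
open import Data.Fin.Properties using (toℕ≤pred[n])
open import Data.Integer as ℤ using (ℤ) renaming (+_ to pos)
open import Data.Integer.Properties using (+-injective; neg-involutive)
open import Data.Integer.Tactic.RingSolver using (solve-∀)
open import Data.List using (List; []; _∷_; [_]; _++_; foldr; concatMap; map; upTo; lookup; length; replicate)
open import Data.List.Membership.Propositional using (_∈_; find; lose)
open import Data.List.Membership.Propositional.Properties
open import Data.List.NonEmpty using (List⁺; _∷_; toList)
open import Data.List.Properties
  using (foldr-++; ++-assoc; ++-identityʳ; ++-cancelˡ; concatMap-++; map-++; ∷-injective; ∷-injectiveʳ)
open import Data.List.Relation.Binary.Pointwise using (Pointwise; []; _∷_)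
open import Data.List.Relation.Binary.Subset.Propositional using (_⊆_)
open import Data.List.Relation.Unary.All as All using (All; []; _∷_)
open import Data.List.Relation.Unary.All.Properties using (++⁺; ++⁻; map⁺)
open import Data.List.Relation.Unary.Any using (here; there; index)
open import Data.List.Relation.Unary.Any.Properties using (lookup-index)
open import Data.Nat using (ℕ; zero; suc; _+_; _<_; _≤_; _⊔_; s≤s; z≤n; _≟_)
open import Data.Nat.Properties
open import Data.Product using (Σ; ∃; ∃₂; _×_; _,_; proj₁; proj₂)
open import Data.Sum using (inj₁; inj₂)
open import Data.Vec as Vec using (Vec; []; _∷_)
open import Data.Vec.Properties using (lookup-map)
open import Data.Vec.Relation.Unary.All as VecAll using ([]; _∷_)
open import Data.Vec.Relation.Unary.All.Properties using (lookup⁺)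
open import Function using (_∘_)
open import Relation.Binary.PropositionalEquality as ≡
  using (_≡_; _≢_; cong; cong₂; subst; subst₂; module ≡-Reasoning)
open import Relation.Nullary using (¬_; yes; no)

-- Braids

record V : Set where
  constructor ⟨_,_,_,_⟩
  field a b c d : ℤ

-- The Burau representation at t = -1, in coordinates adapted to the sum of the image and
-- the fixed space of ⟨ σ₁ , σ₂ ⟩.
actLetter : Letter → V → V
actLetter (zero , true)  ⟨ a , b , c , d ⟩ = ⟨ a ℤ.- b , b , c , d ⟩
actLetter (zero , false) ⟨ a , b , c , d ⟩ = ⟨ a ℤ.+ b , b , c , d ⟩
actLetter (suc zero , true)  ⟨ a , b , c , d ⟩ = ⟨ a , b ℤ.+ a , c , d ⟩
actLetter (suc zero , false) ⟨ a , b , c , d ⟩ = ⟨ a , b ℤ.- a , c , d ⟩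
actLetter (suc (suc zero) , true)  ⟨ a , b , c , d ⟩ = ⟨ a ℤ.- b ℤ.+ d , b , c ℤ.+ b ℤ.- d , d ⟩
actLetter (suc (suc zero) , false) ⟨ a , b , c , d ⟩ = ⟨ a ℤ.+ b ℤ.- d , b , c ℤ.- b ℤ.+ d , d ⟩
actLetter (suc (suc (suc zero)) , true)  ⟨ a , b , c , d ⟩ = ⟨ a , b , c , d ℤ.+ c ⟩
actLetter (suc (suc (suc zero)) , false) ⟨ a , b , c , d ⟩ = ⟨ a , b , c , d ℤ.- c ⟩

act : BraidWord → V → V
act w v = foldr actLetter v w

⟨⟩-cong : ∀ {a a′ b b′ c c′ d d′} → a ≡ a′ → b ≡ b′ → c ≡ c′ → d ≡ d′ →
          ⟨ a , b , c , d ⟩ ≡ ⟨ a′ , b′ , c′ , d′ ⟩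
⟨⟩-cong ≡.refl ≡.refl ≡.refl ≡.refl = ≡.refl

+-−-cancel : ∀ x y → x ℤ.+ y ℤ.- y ≡ x
+-−-cancel = solve-∀

−-+-cancel : ∀ x y → x ℤ.- y ℤ.+ y ≡ x
−-+-cancel = solve-∀

+−−+-cancel : ∀ x y z → x ℤ.+ y ℤ.- z ℤ.- y ℤ.+ z ≡ x
+−−+-cancel = solve-∀

−++−-cancel : ∀ x y z → x ℤ.- y ℤ.+ z ℤ.+ y ℤ.- z ≡ x
−++−-cancel = solve-∀

act-cancel : ∀ i b v → act ((i , b) ∷ (i , not b) ∷ []) v ≡ v
act-cancel zero true ⟨ a , b , c , d ⟩ = ⟨⟩-cong (+-−-cancel a b) ≡.refl ≡.refl ≡.refl
act-cancel zero false ⟨ a , b , c , d ⟩ = ⟨⟩-cong (−-+-cancel a b) ≡.refl ≡.refl ≡.refl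
act-cancel (suc zero) true ⟨ a , b , c , d ⟩ = ⟨⟩-cong ≡.refl (−-+-cancel b a) ≡.refl ≡.refl
act-cancel (suc zero) false ⟨ a , b , c , d ⟩ = ⟨⟩-cong ≡.refl (+-−-cancel b a) ≡.refl ≡.refl
act-cancel (suc (suc zero)) true ⟨ a , b , c , d ⟩ =
  ⟨⟩-cong (+−−+-cancel a b d) ≡.refl (−++−-cancel c b d) ≡.refl
act-cancel (suc (suc zero)) false ⟨ a , b , c , d ⟩ =
  ⟨⟩-cong (−++−-cancel a b d) ≡.refl (+−−+-cancel c b d) ≡.refl
act-cancel (suc (suc (suc zero))) true ⟨ a , b , c , d ⟩ = ⟨⟩-cong ≡.refl ≡.refl ≡.refl (−-+-cancel d c)
act-cancel (suc (suc (suc zero))) false ⟨ a , b , c , d ⟩ = ⟨⟩-cong ≡.refl ≡.refl ≡.refl (+-−-cancel d c)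

Commute : Letter → Letter → Set
Commute x y = ∀ v → actLetter x (actLetter y v) ≡ actLetter y (actLetter x v)

commute-inverse : ∀ {i y} → Commute (i , true) y → ∀ b → Commute (i , b) y
commute-inverse xy true = xy
commute-inverse {i} {y} xy false v = begin
  actLetter (i , false) (actLetter y v)
    ≡⟨ cong (λ u → actLetter (i , false) (actLetter y u)) (act-cancel i true v) ⟨
  actLetter (i , false) (actLetter y (act ((i , true) ∷ (i , false) ∷ []) v))
    ≡⟨ cong (actLetter (i , false)) (xy _) ⟨
  act ((i , false) ∷ (i , true) ∷ []) (actLetter y (actLetter (i , false) v))
    ≡⟨ act-cancel i false _ ⟩
  actLetter y (actLetter (i , false) v) ∎
  where open ≡-Reasoning

-- Inserting a cancelling pair trades a generator for its inverse, and by symmetry this works on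
-- either side. So only positive letters need computation, and of these only σ₁ with σ₃ is not
-- immediate.
commute-signs : ∀ {i j} → Commute (i , true) (j , true) → ∀ b c → Commute (i , b) (j , c)
commute-signs xy b c = commute-inverse (≡.sym ∘ commute-inverse (≡.sym ∘ xy) c) b

commute₁₃ : Commute (zero , true) (suc (suc zero) , true)
commute₁₃ ⟨ a , b , c , d ⟩ = ⟨⟩-cong (h a b d) ≡.refl ≡.refl ≡.refl
  where
  h : ∀ a b d → a ℤ.- b ℤ.+ d ℤ.- b ≡ a ℤ.- b ℤ.- b ℤ.+ d
  h = solve-∀

act-far : ∀ i j b c → suc (toℕ i) < toℕ j → Commute (i , b) (j , c)
act-far zero (suc zero) b c (s≤s ())
act-far zero (suc (suc zero)) b c _ = commute-signs commute₁₃ b c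
act-far zero (suc (suc (suc zero))) b c _ = commute-signs (λ _ → ≡.refl) b c
act-far (suc zero) (suc zero) b c (s≤s ())
act-far (suc zero) (suc (suc zero)) b c (s≤s (s≤s ()))
act-far (suc zero) (suc (suc (suc zero))) b c _ = commute-signs (λ _ → ≡.refl) b c
-- Here `j` would have to exceed 3.
act-far (suc (suc i)) j b c i<j =
  ⊥-elim (<⇒≱ (<-≤-trans i<j (toℕ≤pred[n] j)) (s≤s (s≤s (s≤s z≤n))))

act-commute : ∀ i j b c → FarApart i j → Commute (i , b) (j , c)
act-commute i j b c (inj₁ i<j) = act-far i j b c i<j
act-commute i j b c (inj₂ j<i) = ≡.sym ∘ act-far j i c b j<i

act-elementary : ∀ {l r} → Elementary l r → ∀ v → act l v ≡ act r v
act-elementary (cancel i b) v = act-cancel i b v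
act-elementary (commute i j b c f) v = act-commute i j b c f v
act-elementary (braid zero) ⟨ a , b , c , d ⟩ = ⟨⟩-cong (h₁ a b) (h₂ a b) ≡.refl ≡.refl
  where
  h₁ : ∀ a b → a ℤ.- b ℤ.- (b ℤ.+ (a ℤ.- b)) ≡ a ℤ.- (b ℤ.+ a)
  h₁ = solve-∀
  h₂ : ∀ a b → b ℤ.+ (a ℤ.- b) ≡ b ℤ.+ a ℤ.+ (a ℤ.- (b ℤ.+ a))
  h₂ = solve-∀
act-elementary (braid (suc zero)) ⟨ a , b , c , d ⟩ = ⟨⟩-cong (h₁ a b d) (h₂ a b d) (h₃ a b c d) ≡.refl
  where
  h₁ : ∀ a b d → a ℤ.- (b ℤ.+ a) ℤ.+ d ≡
       a ℤ.- b ℤ.+ d ℤ.- (b ℤ.+ (a ℤ.- b ℤ.+ d)) ℤ.+ d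
  h₁ = solve-∀
  h₂ : ∀ a b d → b ℤ.+ a ℤ.+ (a ℤ.- (b ℤ.+ a) ℤ.+ d) ≡ b ℤ.+ (a ℤ.- b ℤ.+ d)
  h₂ = solve-∀
  h₃ : ∀ a b c d → c ℤ.+ (b ℤ.+ a) ℤ.- d ≡
       c ℤ.+ b ℤ.- d ℤ.+ (b ℤ.+ (a ℤ.- b ℤ.+ d)) ℤ.- d
  h₃ = solve-∀
act-elementary (braid (suc (suc zero))) ⟨ a , b , c , d ⟩ = ⟨⟩-cong (h₁ a b c d) ≡.refl (h₂ b c d) (h₃ b c d)
  where
  h₁ : ∀ a b c d → a ℤ.- b ℤ.+ d ℤ.- b ℤ.+ (d ℤ.+ (c ℤ.+ b ℤ.- d)) ≡ a ℤ.- b ℤ.+ (d ℤ.+ c)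
  h₁ = solve-∀
  h₂ : ∀ b c d → c ℤ.+ b ℤ.- d ℤ.+ b ℤ.- (d ℤ.+ (c ℤ.+ b ℤ.- d)) ≡ c ℤ.+ b ℤ.- (d ℤ.+ c)
  h₂ = solve-∀
  h₃ : ∀ b c d → d ℤ.+ (c ℤ.+ b ℤ.- d) ≡ d ℤ.+ c ℤ.+ (c ℤ.+ b ℤ.- (d ℤ.+ c))
  h₃ = solve-∀

act-++ : ∀ u w v → act (u ++ w) v ≡ act u (act w v)
act-++ u w v = foldr-++ actLetter v u w

act-≈B : ∀ {u w} → u ≈B w → ∀ v → act u v ≡ act w v
act-≈B (step u w {l} {r} e) v = begin
  act (u ++ l ++ w) v     ≡⟨ act-++ u (l ++ w) v ⟩
  act u (act (l ++ w) v)  ≡⟨ cong (act u) (act-++ l w v) ⟩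
  act u (act l (act w v)) ≡⟨ cong (act u) (act-elementary e _) ⟩
  act u (act r (act w v)) ≡⟨ cong (act u) (act-++ r w v) ⟨
  act u (act (r ++ w) v)  ≡⟨ act-++ u (r ++ w) v ⟨
  act (u ++ r ++ w) v     ∎
  where open ≡-Reasoning
act-≈B refl v = ≡.refl
act-≈B (sym e) v = ≡.sym (act-≈B e v)
act-≈B (trans e f) v = ≡.trans (act-≈B e v) (act-≈B f v)

≈B-congˡ : ∀ p {u w} → u ≈B w → p ++ u ≈B p ++ w
≈B-congˡ p (step u w {l} {r} e)
  rewrite ≡.sym (++-assoc p u (l ++ w)) | ≡.sym (++-assoc p u (r ++ w)) = step (p ++ u) w e
≈B-congˡ p refl = refl
≈B-congˡ p (sym e) = sym (≈B-congˡ p e)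
≈B-congˡ p (trans e f) = trans (≈B-congˡ p e) (≈B-congˡ p f)

≈B-congʳ : ∀ q {u w} → u ≈B w → u ++ q ≈B w ++ q
≈B-congʳ q (step u w {l} {r} e)
  rewrite ++-assoc u (l ++ w) q | ++-assoc u (r ++ w) q | ++-assoc l w q | ++-assoc r w q = step u (w ++ q) e
≈B-congʳ q refl = refl
≈B-congʳ q (sym e) = sym (≈B-congʳ q e)
≈B-congʳ q (trans e f) = trans (≈B-congʳ q e) (≈B-congʳ q f)

-- Two commuting pairs of braids

pattern σ₁ = (zero , true)
pattern σ₂ = (suc zero , true)
pattern σ₃ = (suc (suc zero) , true)
pattern σ₄ = (suc (suc (suc zero)) , true)

-- The pure braid in which the last strand encircles the other four.
wind : BraidWord
wind = σ₄ ∷ σ₃ ∷ σ₂ ∷ σ₁ ∷ σ₁ ∷ σ₂ ∷ σ₃ ∷ σ₄ ∷ []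

infixr 4 _⟫_
_⟫_ : ∀ {u v w} → u ≈B v → v ≈B w → u ≈B w
_⟫_ = trans

commute-σ₁σ₃ : Elementary (σ₁ ∷ σ₃ ∷ []) (σ₃ ∷ σ₁ ∷ [])
commute-σ₁σ₃ = commute _ _ _ _ (inj₁ (s≤s (s≤s z≤n)))

commute-σ₁σ₄ : Elementary (σ₁ ∷ σ₄ ∷ []) (σ₄ ∷ σ₁ ∷ [])
commute-σ₁σ₄ = commute _ _ _ _ (inj₁ (s≤s (s≤s z≤n)))

commute-σ₂σ₄ : Elementary (σ₂ ∷ σ₄ ∷ []) (σ₄ ∷ σ₂ ∷ [])
commute-σ₂σ₄ = commute _ _ _ _ (inj₁ (s≤s (s≤s (s≤s z≤n))))

commute-σ₃σ₁ : Elementary (σ₃ ∷ σ₁ ∷ []) (σ₁ ∷ σ₃ ∷ [])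
commute-σ₃σ₁ = commute _ _ _ _ (inj₂ (s≤s (s≤s z≤n)))

-- A braid relation turns σ₁ into σ₂ in the descending half of `wind`, and another turns it back in
-- the ascending half; all other letters commute with it. In `σ₂-wind` the letter in the middle is
-- σ₃.
σ₁-wind : σ₁ ∷ wind ≈B wind ++ σ₁ ∷ []
σ₁-wind =
  step [] _ commute-σ₁σ₄ ⟫
  step (σ₄ ∷ []) _ commute-σ₁σ₃ ⟫
  step (σ₄ ∷ σ₃ ∷ []) _ (braid zero) ⟫
  sym (step (σ₄ ∷ σ₃ ∷ σ₂ ∷ σ₁ ∷ []) (σ₃ ∷ σ₄ ∷ []) (braid zero)) ⟫
  step (σ₄ ∷ σ₃ ∷ σ₂ ∷ σ₁ ∷ σ₁ ∷ σ₂ ∷ []) _ commute-σ₁σ₃ ⟫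
  step (σ₄ ∷ σ₃ ∷ σ₂ ∷ σ₁ ∷ σ₁ ∷ σ₂ ∷ σ₃ ∷ []) _ commute-σ₁σ₄

σ₂-wind : σ₂ ∷ wind ≈B wind ++ σ₂ ∷ []
σ₂-wind =
  step [] _ commute-σ₂σ₄ ⟫
  step (σ₄ ∷ []) _ (braid (suc zero)) ⟫
  step (σ₄ ∷ σ₃ ∷ σ₂ ∷ []) _ commute-σ₃σ₁ ⟫
  step (σ₄ ∷ σ₃ ∷ σ₂ ∷ σ₁ ∷ []) _ commute-σ₃σ₁ ⟫
  sym (step (σ₄ ∷ σ₃ ∷ σ₂ ∷ σ₁ ∷ σ₁ ∷ []) (σ₄ ∷ []) (braid (suc zero))) ⟫
  step (σ₄ ∷ σ₃ ∷ σ₂ ∷ σ₁ ∷ σ₁ ∷ σ₂ ∷ σ₃ ∷ []) _ commute-σ₂σ₄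

commutes-++ : ∀ u v w → u ++ v ≈B v ++ u → u ++ w ≈B w ++ u → u ++ (v ++ w) ≈B (v ++ w) ++ u
commutes-++ u v w uv uw = subst₂ _≈B_ (++-assoc u v w) (++-assoc v u w)
  (≈B-congʳ w uv) ⟫ subst (v ++ (u ++ w) ≈B_) (≡.sym (++-assoc v w u)) (≈B-congˡ v uw)

commutes-inverse : ∀ i v → (i , true) ∷ v ≈B v ++ (i , true) ∷ [] →
                   (i , false) ∷ v ≈B v ++ (i , false) ∷ []
commutes-inverse i v e =
  subst ((i , false) ∷ v ≈B_) (cong ((i , false) ∷_) (≡.sym (++-assoc v _ _)))
    (subst (λ w → (i , false) ∷ w ≈B (i , false) ∷ (v ++ (i , true) ∷ (i , false) ∷ [])) (++-identityʳ v)
      (≈B-congˡ ((i , false) ∷ v) (sym (step [] [] (cancel i true))))) ⟫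
  ≈B-congˡ ((i , false) ∷ []) (sym (≈B-congʳ ((i , false) ∷ []) e)) ⟫
  step [] (v ++ (i , false) ∷ []) (cancel i false)

-- With σ₁ inverted, both letters of `xy` add one of the coordinates a, b to the other. Since `wind`
-- reverses signs it is squared, which leaves the shear adding 4d to c; σ₄ adds c to d. Each pair
-- fixes the plane of the other.
xy zt : Bool → BraidWord
xy true  = σ₂ ∷ []
xy false = (zero , false) ∷ []
zt true  = σ₄ ∷ []
zt false = wind ++ wind

xy-zt : ∀ b c → xy b ++ zt c ≈B zt c ++ xy b
xy-zt true true = step [] [] commute-σ₂σ₄
xy-zt true false = commutes-++ (σ₂ ∷ []) wind wind σ₂-wind σ₂-wind
xy-zt false true = step [] [] (commute _ _ _ _ (inj₁ (s≤s (s≤s z≤n))))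
xy-zt false false = commutes-inverse zero (wind ++ wind) (commutes-++ (σ₁ ∷ []) wind wind σ₁-wind σ₁-wind)

spell : (Bool → BraidWord) → List Bool → BraidWord
spell g = concatMap g

spell-commutes : ∀ g w → (∀ b → w ++ g b ≈B g b ++ w) → ∀ q → w ++ spell g q ≈B spell g q ++ w
spell-commutes g w c [] rewrite ++-identityʳ w = refl
spell-commutes g w c (b ∷ q) = commutes-++ w (g b) (spell g q) (c b) (spell-commutes g w c q)

spells-commute : ∀ p q → spell xy p ++ spell zt q ≈B spell zt q ++ spell xy p
spells-commute p q = sym (spell-commutes xy (spell zt q)
  (λ b → sym (spell-commutes zt (xy b) (xy-zt b) q)) p)

toBraid : List Bool × List Bool → BraidWord
toBraid (p , q) = spell xy p ++ spell zt q

-- The inner factors, from different pairs, change places.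
toBraid-++ : ∀ p q p′ q′ → toBraid (p , q) ++ toBraid (p′ , q′) ≈B toBraid (p ++ p′ , q ++ q′)
toBraid-++ p q p′ q′ = subst₂ _≈B_ lhs rhs
  (≈B-congˡ P (≈B-congʳ Q′ (sym (spells-commute p′ q))))
  where
  P = spell xy p
  Q = spell zt q
  P′ = spell xy p′
  Q′ = spell zt q′
  lhs : P ++ (Q ++ P′) ++ Q′ ≡ (P ++ Q) ++ (P′ ++ Q′)
  lhs = ≡.trans (cong (P ++_) (++-assoc Q P′ Q′)) (≡.sym (++-assoc P Q (P′ ++ Q′)))
  rhs : P ++ (P′ ++ Q) ++ Q′ ≡ toBraid (p ++ p′ , q ++ q′)
  rhs = begin
    P ++ (P′ ++ Q) ++ Q′   ≡⟨ cong (P ++_) (++-assoc P′ Q Q′) ⟩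
    P ++ P′ ++ Q ++ Q′     ≡⟨ ++-assoc P P′ (Q ++ Q′) ⟨
    (P ++ P′) ++ (Q ++ Q′) ≡⟨ cong₂ _++_ (concatMap-++ xy p p′) (concatMap-++ zt q q′) ⟨
    toBraid (p ++ p′ , q ++ q′) ∎
    where open ≡-Reasoning

-- Recovering the two words from their braid

act-wind : ∀ a b c d → act wind ⟨ a , b , c , d ⟩ ≡ ⟨ ℤ.- a , ℤ.- b , ℤ.- (c ℤ.+ (d ℤ.+ d)) , ℤ.- d ⟩
-- The vector is simplified halfway through `wind`, which keeps the polynomial identities small.
act-wind a b c d = ≡.trans (cong (act (σ₄ ∷ σ₃ ∷ σ₂ ∷ σ₁ ∷ [])) (inner a b c d))
  (outer a b c d)
  where
  inner : ∀ a b c d → act (σ₁ ∷ σ₂ ∷ σ₃ ∷ σ₄ ∷ []) ⟨ a , b , c , d ⟩ ≡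
          ⟨ ℤ.- b , a ℤ.+ c ℤ.+ d , b ℤ.- d , d ℤ.+ c ⟩
  inner a b c d = ⟨⟩-cong (h₁ a b c d) (h₂ a b c d) (h₃ b c d) ≡.refl
    where
    h₁ : ∀ a b c d → a ℤ.- b ℤ.+ (d ℤ.+ c) ℤ.- (b ℤ.+ (a ℤ.- b ℤ.+ (d ℤ.+ c))) ≡ ℤ.- b
    h₁ = solve-∀
    h₂ : ∀ a b c d → b ℤ.+ (a ℤ.- b ℤ.+ (d ℤ.+ c)) ≡ a ℤ.+ c ℤ.+ d
    h₂ = solve-∀
    h₃ : ∀ b c d → c ℤ.+ b ℤ.- (d ℤ.+ c) ≡ b ℤ.- d
    h₃ = solve-∀
  outer : ∀ a b c d → act (σ₄ ∷ σ₃ ∷ σ₂ ∷ σ₁ ∷ []) ⟨ ℤ.- b , a ℤ.+ c ℤ.+ d , b ℤ.- d , d ℤ.+ c ⟩ ≡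
          ⟨ ℤ.- a , ℤ.- b , ℤ.- (c ℤ.+ (d ℤ.+ d)) , ℤ.- d ⟩
  outer a b c d = ⟨⟩-cong (h₁ a b c d) (h₂ a b c d) (h₃ a b c d) (h₄ a b c d)
    where
    h₂ : ∀ a b c d → a ℤ.+ c ℤ.+ d ℤ.+ (ℤ.- b ℤ.- (a ℤ.+ c ℤ.+ d)) ≡ ℤ.- b
    h₂ = solve-∀
    h₁ : ∀ a b c d → ℤ.- b ℤ.- (a ℤ.+ c ℤ.+ d) ℤ.-
         (a ℤ.+ c ℤ.+ d ℤ.+ (ℤ.- b ℤ.- (a ℤ.+ c ℤ.+ d))) ℤ.+ (d ℤ.+ c) ≡ ℤ.- a
    h₁ = solve-∀
    h₃ : ∀ a b c d → b ℤ.- d ℤ.+ (a ℤ.+ c ℤ.+ d ℤ.+ (ℤ.- b ℤ.- (a ℤ.+ c ℤ.+ d))) ℤ.- (d ℤ.+ c) ≡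
         ℤ.- (c ℤ.+ (d ℤ.+ d))
    h₃ = solve-∀
    h₄ : ∀ a b c d → d ℤ.+ c ℤ.+ (b ℤ.- d ℤ.+ (a ℤ.+ c ℤ.+ d ℤ.+ (ℤ.- b ℤ.- (a ℤ.+ c ℤ.+ d))) ℤ.- (d ℤ.+ c)) ≡
         ℤ.- d
    h₄ = solve-∀

act-wind² : ∀ a b c d → act (wind ++ wind) ⟨ a , b , c , d ⟩ ≡ ⟨ a , b , c ℤ.+ (d ℤ.+ d ℤ.+ (d ℤ.+ d)) , d ⟩
act-wind² a b c d = begin
  act (wind ++ wind) ⟨ a , b , c , d ⟩      ≡⟨ act-++ wind wind ⟨ a , b , c , d ⟩ ⟩
  act wind (act wind ⟨ a , b , c , d ⟩)     ≡⟨ cong (act wind) (act-wind a b c d) ⟩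
  act wind ⟨ ℤ.- a , ℤ.- b , ℤ.- (c ℤ.+ (d ℤ.+ d)) , ℤ.- d ⟩ ≡⟨ act-wind _ _ _ _ ⟩
  _ ≡⟨ ⟨⟩-cong (neg-involutive a) (neg-involutive b) (h c d) (neg-involutive d) ⟩
  ⟨ a , b , c ℤ.+ (d ℤ.+ d ℤ.+ (d ℤ.+ d)) , d ⟩ ∎
  where
  open ≡-Reasoning
  h : ∀ c d → ℤ.- (ℤ.- (c ℤ.+ (d ℤ.+ d)) ℤ.+ (ℤ.- d ℤ.+ ℤ.- d)) ≡ c ℤ.+ (d ℤ.+ d ℤ.+ (d ℤ.+ d))
  h = solve-∀

-- Euclid's algorithm recovers the word from the pair.
module Euclid (f : ℕ → ℕ) (n≤fn : ∀ n → n ≤ f n) where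

  euclid : List Bool → ℕ × ℕ
  euclid [] = 1 , 1
  euclid (true  ∷ p) = let a , b = euclid p in a , b + a
  euclid (false ∷ p) = let a , b = euclid p in a + f b , b

  positive : ∀ p → 0 < proj₁ (euclid p) × 0 < proj₂ (euclid p)
  positive [] = s≤s z≤n , s≤s z≤n
  positive (true ∷ p) = let 0<a , 0<b = positive p in 0<a , ≤-trans 0<b (m≤m+n _ _)
  positive (false ∷ p) = let 0<a , 0<b = positive p in ≤-trans 0<a (m≤m+n _ _) , 0<b

  -- The larger entry betrays the first letter, and only the empty word gives equal entries. This is
  -- what makes the pair decodable.
  true-< : ∀ p → proj₁ (euclid (true ∷ p)) < proj₂ (euclid (true ∷ p))
  true-< p = +-mono-≤ (proj₂ (positive p)) ≤-refl

  false-> : ∀ p → proj₂ (euclid (false ∷ p)) < proj₁ (euclid (false ∷ p))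
  false-> p = +-mono-≤ (proj₁ (positive p)) (n≤fn _)

  euclid-injective : ∀ p q → euclid p ≡ euclid q → p ≡ q
  euclid-injective [] [] e = ≡.refl
  euclid-injective [] (true ∷ q) e = ⊥-elim (<-irrefl ≡.refl (subst (λ r → proj₁ r < proj₂ r) (≡.sym e) (true-< q)))
  euclid-injective [] (false ∷ q) e = ⊥-elim (<-irrefl ≡.refl (subst (λ r → proj₂ r < proj₁ r) (≡.sym e) (false-> q)))
  euclid-injective (true ∷ p) [] e = ⊥-elim (<-irrefl ≡.refl (subst (λ r → proj₁ r < proj₂ r) e (true-< p)))
  euclid-injective (false ∷ p) [] e = ⊥-elim (<-irrefl ≡.refl (subst (λ r → proj₂ r < proj₁ r) e (false-> p)))
  euclid-injective (true ∷ p) (false ∷ q) e =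
    ⊥-elim (<-asym (false-> q) (subst (λ r → proj₁ r < proj₂ r) e (true-< p)))
  euclid-injective (false ∷ p) (true ∷ q) e =
    ⊥-elim (<-asym (true-< q) (subst (λ r → proj₂ r < proj₁ r) e (false-> p)))
  euclid-injective (true ∷ p) (true ∷ q) e
    with euclid p | euclid q | euclid-injective p q | cong proj₁ e | cong proj₂ e
  ... | a , b | _ , b′ | rec | ≡.refl | e₂ = cong (true ∷_) (rec (cong (a ,_) (+-cancelʳ-≡ a b b′ e₂)))
  euclid-injective (false ∷ p) (false ∷ q) e
    with euclid p | euclid q | euclid-injective p q | cong proj₂ e | cong proj₁ e
  ... | a , b | a′ , _ | rec | ≡.refl | e₁ = cong (false ∷_) (rec (cong (_, b) (+-cancelʳ-≡ (f b) a a′ e₁)))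

module Euclid₁ = Euclid (λ n → n) (λ n → ≤-refl)
-- The factor four is the shear of `act-wind²`.
module Euclid₄ = Euclid (λ n → (n + n) + (n + n)) (λ n → ≤-trans (m≤m+n n n) (m≤m+n _ _))

act-xy : ∀ p c d → act (spell xy p) ⟨ pos 1 , pos 1 , c , d ⟩ ≡
         (let a , b = Euclid₁.euclid p in ⟨ pos a , pos b , c , d ⟩)
act-xy [] c d = ≡.refl
act-xy (true ∷ p) c d = cong (actLetter σ₂) (act-xy p c d)
act-xy (false ∷ p) c d = cong (actLetter (zero , false)) (act-xy p c d)

act-zt : ∀ q a b → act (spell zt q) ⟨ a , b , pos 1 , pos 1 ⟩ ≡
         (let c , d = Euclid₄.euclid q in ⟨ a , b , pos c , pos d ⟩)
act-zt [] a b = ≡.refl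
act-zt (true ∷ q) a b = cong (actLetter σ₄) (act-zt q a b)
act-zt (false ∷ q) a b =
  let c , d = Euclid₄.euclid q
  in ≡.trans (act-++ (wind ++ wind) (spell zt q) ⟨ a , b , pos 1 , pos 1 ⟩)
       (≡.trans (cong (act (wind ++ wind)) (act-zt q a b)) (act-wind² a b (pos c) (pos d)))

act-toBraid : ∀ p q → act (toBraid (p , q)) ⟨ pos 1 , pos 1 , pos 1 , pos 1 ⟩ ≡
  (let a , b = Euclid₁.euclid p ; c , d = Euclid₄.euclid q in ⟨ pos a , pos b , pos c , pos d ⟩)
act-toBraid p q = ≡.trans (act-++ (spell xy p) (spell zt q) _)
  (≡.trans (cong (act (spell xy p)) (act-zt q _ _)) (act-xy p _ _))

-- One vector tests both words, as each is decoded from its own two coordinates of the image of (1,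
-- 1, 1, 1).
toBraid-injective : ∀ {p q p′ q′} → toBraid (p , q) ≈B toBraid (p′ , q′) → (p , q) ≡ (p′ , q′)
toBraid-injective {p} {q} {p′} {q′} e
  with ≡.trans (≡.sym (act-toBraid p q)) (≡.trans (act-≈B e ⟨ pos 1 , pos 1 , pos 1 , pos 1 ⟩) (act-toBraid p′ q′))
... | eq = cong₂ _,_
  (Euclid₁.euclid-injective p p′ (cong₂ _,_ (+-injective (cong V.a eq)) (+-injective (cong V.b eq))))
  (Euclid₄.euclid-injective q q′ (cong₂ _,_ (+-injective (cong V.c eq)) (+-injective (cong V.d eq))))

-- Queue rewriting and dominoes

-- Compatibility: one of the two lists is a prefix of the other.
data _~_ {A : Set} : List A → List A → Set where
  []ˡ : ∀ {v} → [] ~ v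
  []ʳ : ∀ {u} → u ~ []
  _∷_ : ∀ a {u v} → u ~ v → (a ∷ u) ~ (a ∷ v)

~-prefix : ∀ {A : Set} {u : List A} v {w} → u ~ (v ++ w) → u ~ v
~-prefix [] _ = []ʳ
~-prefix (a ∷ v) []ˡ = []ˡ
~-prefix (a ∷ v) (.a ∷ c) = a ∷ ~-prefix v c

~-sym : ∀ {A : Set} {u v : List A} → u ~ v → v ~ u
~-sym []ˡ = []ʳ
~-sym []ʳ = []ˡ
~-sym (a ∷ c) = a ∷ ~-sym c

data Ext (Sym : Set) : Set where
  tape : Sym → Ext Sym
  sep end start : Ext Sym

module _ {Sym : Set} where

  sepBefore sepAfter : List Sym → List (Ext Sym)
  sepBefore [] = []
  sepBefore (a ∷ w) = sep ∷ tape a ∷ sepBefore w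
  sepAfter [] = []
  sepAfter (a ∷ w) = tape a ∷ sep ∷ sepAfter w

  sepBefore-++ : ∀ u v → sepBefore (u ++ v) ≡ sepBefore u ++ sepBefore v
  sepBefore-++ [] v = ≡.refl
  sepBefore-++ (a ∷ u) v = cong (λ w → sep ∷ tape a ∷ w) (sepBefore-++ u v)

  -- The two spellings of a word differ by a shift of one separator. The right start tile supplies
  -- that separator, and it stays at the end of the right side as words are consumed.
  sep-shift : ∀ w x → sep ∷ (sepAfter w ++ x) ≡ sepBefore w ++ sep ∷ x
  sep-shift [] x = ≡.refl
  sep-shift (a ∷ w) x = cong (λ v → sep ∷ tape a ∷ v) (sep-shift w x)

  map-tape-~ : ∀ u v {x y : List (Ext Sym)} → map tape u ++ x ≡ map tape v ++ y → u ~ v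
  map-tape-~ [] v e = []ˡ
  map-tape-~ (a ∷ u) [] e = []ʳ
  map-tape-~ (a ∷ u) (b ∷ v) e with ∷-injective e
  ... | ≡.refl , e′ = a ∷ map-tape-~ u v e′

  start≢map-tape : ∀ {u : List Sym} {x y} → u ≢ [] → start ∷ x ≢ map tape u ++ y
  start≢map-tape {[]} ne e = ne ≡.refl
  start≢map-tape {_ ∷ _} ne ()

  map-tape≢[] : ∀ {u : List Sym} {x} → u ≢ [] → map tape u ++ x ≢ []
  map-tape≢[] {[]} ne e = ne ≡.refl
  map-tape≢[] {_ ∷ _} ne ()

  data SepFirst : List (Ext Sym) → Set where
    sep-first  : ∀ {w} → SepFirst (sep ∷ w)

  sepBefore-first : ∀ {v} → v ≢ [] → SepFirst (sepBefore v)
  sepBefore-first {[]} ne = ⊥-elim (ne ≡.refl)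
  sepBefore-first {_ ∷ _} ne = sep-first

  SepFirst-sepAfter : ∀ {u v x y} → SepFirst v → u ≢ [] → v ++ x ≢ sepAfter u ++ y
  SepFirst-sepAfter {[]} _ ne e = ne ≡.refl
  SepFirst-sepAfter {_ ∷ _} sep-first ne ()

  -- A separator and a tape letter are removed at a time, so the leading separator survives. The
  -- word `r` cannot run out before `u`, since `tape c` would then face a separator.
  sepAfter-phase : ∀ u r {c Y Z} → sepBefore r ++ tape c ∷ Y ≡ sep ∷ sepAfter u ++ Z →
                   ∃ λ r′ → sepBefore r′ ++ tape c ∷ Y ≡ sep ∷ Z
  sepAfter-phase [] r e = r , e
  sepAfter-phase (b ∷ u) [] ()
  sepAfter-phase (b ∷ u) (a ∷ r) e = sepAfter-phase u r (∷-injectiveʳ (∷-injectiveʳ e))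

  sepBefore-~ : ∀ u v {x y : List (Ext Sym)} → sepBefore u ++ x ≡ sepBefore v ++ y → u ~ v
  sepBefore-~ [] v e = []ˡ
  sepBefore-~ (a ∷ u) [] e = []ʳ
  sepBefore-~ (a ∷ u) (b ∷ v) e with ∷-injective (∷-injectiveʳ e)
  ... | ≡.refl , e′ = a ∷ sepBefore-~ u v e′

-- A Post normal system.
module Queue {Sym : Set} (Rule : List Sym → List Sym → Set) where

  infixr 5 _∷⟨_⟩_
  data _⇝*_ : List Sym → List Sym → Set where
    []  : ∀ {w} → w ⇝* w
    _∷⟨_⟩_ : ∀ {u v w} → Rule u v → ∀ r → (r ++ v) ⇝* w → (u ++ r) ⇝* w

  ⇝*-trans : ∀ {u v w} → u ⇝* v → v ⇝* w → u ⇝* w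
  ⇝*-trans [] q = q
  ⇝*-trans (ρ ∷⟨ r ⟩ p) q = ρ ∷⟨ r ⟩ ⇝*-trans p q

  rotate : ∀ {w} → All (λ x → Rule (x ∷ []) (x ∷ [])) w → ∀ r → (w ++ r) ⇝* (r ++ w)
  rotate [] r = subst (r ⇝*_) (≡.sym (++-identityʳ r)) []
  rotate {x ∷ w} (c ∷ cs) r = c ∷⟨ w ++ r ⟩ subst₂ _⇝*_
    (≡.sym (++-assoc w r (x ∷ []))) (++-assoc r (x ∷ []) w) (rotate cs (r ++ x ∷ []))

  -- The rule puts `v` at the back; copying the rest once around the queue brings it to the front.
  -- Thus the queue simulates local rewriting.
  rewrite-front : ∀ {u v} → Rule u v → ∀ {r} → All (λ x → Rule (x ∷ []) (x ∷ [])) r → (u ++ r) ⇝* (v ++ r)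
  rewrite-front {v = v} ρ {r} cs = ρ ∷⟨ r ⟩ rotate cs v

-- The conditions `deterministic` and `final-irreducible` speak of compatibility because equal
-- concatenations show of their first parts only that one is a prefix of the other.
record QueueSystem : Set₁ where
  field
    Sym  : Set
    Rule : List Sym → List Sym → Set
    init final : List Sym
    lhs-nonempty : ∀ {u v} → Rule u v → u ≢ []
    rhs-nonempty : ∀ {u v} → Rule u v → v ≢ []
    init-nonempty : init ≢ []
    final-nonempty : final ≢ []
    deterministic : ∀ {u v u′ v′} → Rule u v → Rule u′ v′ → u ~ u′ → u ≡ u′ × v ≡ v′
    final-irreducible : ∀ {u v} → Rule u v → ¬ (final ~ u)

module Dominoes (S : QueueSystem) where
  open QueueSystem S
  open Queue Rule public

  -- In `stuck` it is not enough that no rule applies: a queue that is a proper prefix of a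
  -- left-hand side would not exclude the next right tile.
  data Dead : List Sym → Set where
    stuck : ∀ {a w} → (∀ {u v} → Rule u v → ¬ (u ~ (a ∷ w))) → ¬ (final ~ (a ∷ w)) → Dead (a ∷ w)
    run   : ∀ {u v} → Rule u v → ∀ r → Dead (r ++ v) → Dead (u ++ r)

  ⇝*-Dead : ∀ {v w} → v ⇝* w → Dead w → Dead v
  ⇝*-Dead [] d = d
  ⇝*-Dead (ρ ∷⟨ r ⟩ p) d = run ρ r (⇝*-Dead p d)

  -- A domino has a key and two alternative values.  When the left values spell an initial part of
  -- a run and the right values the part of it already consumed, the left overhang is the queue.
  data Domino : (key left right : List (Ext Sym)) → Set where
    startD : Domino (start ∷ []) (sepBefore init) (sep ∷ [])
    ruleD  : ∀ {u v} → Rule u v → Domino (map tape u) (sepBefore v) (sepAfter u)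
    finalD : Domino (map tape final) (sep ∷ end ∷ []) (sepAfter final ++ end ∷ [])

  Tile : Set
  Tile = List (Ext Sym) × List (Ext Sym)

  data IsTile : Tile → Set where
    left  : ∀ {k l r} → Domino k l r → IsTile (k , l)
    right : ∀ {k l r} → Domino k l r → IsTile (k , r)

  keys vals : List Tile → List (Ext Sym)
  keys = concatMap proj₁
  vals = concatMap proj₂

  -- Distinct keys are incompatible, so the keys form a prefix code, and by determinism a key
  -- determines both values.
  domino-unique : ∀ {k l r k′ l′ r′ x y} → Domino k l r → Domino k′ l′ r′ → k ++ x ≡ k′ ++ y →
                  (k , l , r) ≡ (k′ , l′ , r′)
  domino-unique startD startD e = ≡.refl
  domino-unique startD (ruleD ρ) e = ⊥-elim (start≢map-tape (lhs-nonempty ρ) e)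
  domino-unique startD finalD e = ⊥-elim (start≢map-tape final-nonempty e)
  domino-unique (ruleD ρ) startD e = ⊥-elim (start≢map-tape (lhs-nonempty ρ) (≡.sym e))
  domino-unique (ruleD {u} ρ) (ruleD {u′} ρ′) e with deterministic ρ ρ′ (map-tape-~ u u′ e)
  ... | ≡.refl , ≡.refl = ≡.refl
  domino-unique (ruleD {u} ρ) finalD e = ⊥-elim (final-irreducible ρ (map-tape-~ final u (≡.sym e)))
  domino-unique finalD startD e = ⊥-elim (start≢map-tape final-nonempty (≡.sym e))
  domino-unique finalD (ruleD {u} ρ) e = ⊥-elim (final-irreducible ρ (map-tape-~ final u e))
  domino-unique finalD finalD e = ≡.refl

  key-nonempty : ∀ {k l r} → Domino k l r → ∀ {x} → k ++ x ≢ []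
  key-nonempty startD ()
  key-nonempty (ruleD ρ) e = map-tape≢[] (lhs-nonempty ρ) e
  key-nonempty finalD e = map-tape≢[] final-nonempty e

  -- The possible next values of the right side. After its trailing separator a value beginning with
  -- `sep` cannot meet a tape letter, which leaves only left-hand sides and `final`.
  data Shape : List (Ext Sym) → List (Ext Sym) → Set where
    sep-first   : ∀ {k w} → SepFirst w → Shape k w
    rule-right  : ∀ u {v} → Rule u v → Shape (map tape u) (sepAfter u)
    final-right : ∀ {k} → Shape k (sepAfter final ++ end ∷ [])

  shape : ∀ {k w} → IsTile (k , w) → Shape k w
  shape (left startD) = sep-first (sepBefore-first init-nonempty)
  shape (left (ruleD ρ)) = sep-first (sepBefore-first (rhs-nonempty ρ))
  shape (left finalD) = sep-first sep-first
  shape (right startD) = sep-first sep-first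
  shape (right (ruleD {u} ρ)) = rule-right u ρ
  shape (right finalD) = final-right

  -- The next separator on the two sides comes at positions of different parity.
  out-of-phase : ∀ {tt} → All IsTile tt → ∀ r {c Y} → sepBefore r ++ tape c ∷ Y ≢ sep ∷ vals tt
  out-of-phase _ [] ()
  out-of-phase [] (a ∷ r) ()
  out-of-phase {_ ∷ tt} (t ∷ ts) (a ∷ r) e with shape t
  out-of-phase {_ ∷ tt} (t ∷ ts) (a ∷ r) () | sep-first sep-first
  ... | rule-right u ρ = let r′ , e′ = sepAfter-phase u (a ∷ r) e in out-of-phase ts r′ e′
  ... | final-right with sepAfter-phase final (a ∷ r) {Z = end ∷ vals tt}
                           (≡.trans e (cong (sep ∷_) (++-assoc (sepAfter final) (end ∷ []) (vals tt))))
  ...   | [] , ()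
  ...   | _ ∷ _ , ()

  final-~ : ∀ tt {q x} → sep ∷ (sepAfter final ++ end ∷ []) ++ vals tt ≡ sepBefore q ++ x → final ~ q
  final-~ tt {q} e = sepBefore-~ final q (≡.trans
    (≡.trans (≡.sym (sep-shift final _)) (cong (sep ∷_) (≡.sym (++-assoc (sepAfter final) _ (vals tt))))) e)

  -- The queue is never empty in a dead configuration, so the next letter of the right side is a
  -- tape letter and the next right tile is forced; by the phase argument so is the left one.
  Dead-no-match : ∀ {q} → Dead q → ∀ {ss tt} → All IsTile ss → All IsTile tt → keys ss ≡ keys tt →
                  sepBefore q ++ vals ss ≢ sep ∷ vals tt
  left-forced : ∀ {u v} → Rule u v → ∀ {r} → Dead (r ++ v) → ∀ {ss tt} → All IsTile ss → All IsTile tt →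
                keys ss ≡ map tape u ++ keys tt → sepBefore r ++ vals ss ≢ sep ∷ vals tt

  Dead-no-match (stuck _ _) S [] ke ()
  Dead-no-match (stuck irr irr′) {tt = _ ∷ tt} S (t ∷ T) ke ve with shape t
  Dead-no-match (stuck irr irr′) S (t ∷ T) ke () | sep-first sep-first
  ... | rule-right u ρ = irr ρ (sepBefore-~ u _ (≡.trans (≡.sym (sep-shift u (vals tt))) (≡.sym ve)))
  ... | final-right = irr′ (final-~ tt (≡.sym ve))
  Dead-no-match (run {[]} ρ _ _) S T ke ve = lhs-nonempty ρ ≡.refl
  Dead-no-match (run {_ ∷ _} ρ r d) S [] ke ()
  Dead-no-match (run {u@(_ ∷ _)} ρ r d) {ss} {_ ∷ tt} S (t ∷ T) ke ve with shape t
  Dead-no-match (run {_ ∷ _} ρ r d) S (t ∷ T) ke () | sep-first sep-first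
  ... | final-right = final-irreducible ρ (~-prefix u (final-~ tt (≡.sym ve)))
  ... | rule-right u′ ρ′
    with deterministic ρ′ ρ (~-prefix u (sepBefore-~ u′ _ (≡.trans (≡.sym (sep-shift u′ (vals tt))) (≡.sym ve))))
  ...   | ≡.refl , ≡.refl = left-forced ρ {r} d S T ke (++-cancelˡ (sepBefore u) _ _ (begin
    sepBefore u ++ sepBefore r ++ vals ss   ≡⟨ ++-assoc (sepBefore u) _ _ ⟨
    (sepBefore u ++ sepBefore r) ++ vals ss ≡⟨ cong (_++ vals ss) (sepBefore-++ u r) ⟨
    sepBefore (u ++ r) ++ vals ss           ≡⟨ ve ⟩
    sep ∷ sepAfter u ++ vals tt             ≡⟨ sep-shift u (vals tt) ⟩
    sepBefore u ++ sep ∷ vals tt            ∎))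
    where open ≡-Reasoning

  left-forced ρ d [] T ke ve = key-nonempty (ruleD ρ) (≡.sym ke)
  left-forced {u} {v} ρ {r} d {_ ∷ ss} {tt} (left D ∷ S) T ke ve with domino-unique D (ruleD ρ) ke
  ... | ≡.refl = Dead-no-match d S T (++-cancelˡ (map tape u) _ _ ke) (begin
    sepBefore (r ++ v) ++ vals ss           ≡⟨ cong (_++ vals ss) (sepBefore-++ r v) ⟩
    (sepBefore r ++ sepBefore v) ++ vals ss ≡⟨ ++-assoc (sepBefore r) _ _ ⟩
    sepBefore r ++ sepBefore v ++ vals ss   ≡⟨ ve ⟩
    sep ∷ vals tt                           ∎)
    where open ≡-Reasoning
  -- The keys force the same rule, but its right value would put a tape letter directly behind `r`,
  -- where the phase calls for a separator.
  left-forced ρ {r} d (right D ∷ S) T ke ve with domino-unique D (ruleD ρ) ke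
  left-forced {[]} ρ d (right D ∷ S) T ke ve | ≡.refl = lhs-nonempty ρ ≡.refl
  left-forced {_ ∷ _} ρ {r} d (right D ∷ S) T ke ve | ≡.refl = out-of-phase T r ve

  -- Left values begin with a separator. Among right values only that of `startD` does too, and
  -- there the overhang is the dead queue `init`.
  left-right-apart : Dead init → ∀ {k l r} → Domino k l r → ∀ {ss tt} → All IsTile ss → All IsTile tt →
                     keys ss ≡ keys tt → l ++ vals ss ≢ r ++ vals tt
  left-right-apart d startD S T ke ve = Dead-no-match d S T ke ve
  left-right-apart d (ruleD ρ) S T ke ve =
    SepFirst-sepAfter (sepBefore-first (rhs-nonempty ρ)) (lhs-nonempty ρ) ve
  left-right-apart d finalD {tt = tt} S T ke ve =
    SepFirst-sepAfter {v = sep ∷ end ∷ []} sep-first final-nonempty (≡.trans ve (++-assoc (sepAfter final) _ (vals tt)))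

  Dead⇒unique : Dead init → ∀ {ss tt} → All IsTile ss → All IsTile tt →
                keys ss ≡ keys tt → vals ss ≡ vals tt → ss ≡ tt
  Dead⇒unique d [] [] ke ve = ≡.refl
  Dead⇒unique d [] (left D ∷ T) ke ve = ⊥-elim (key-nonempty D (≡.sym ke))
  Dead⇒unique d [] (right D ∷ T) ke ve = ⊥-elim (key-nonempty D (≡.sym ke))
  Dead⇒unique d (left D ∷ S) [] ke ve = ⊥-elim (key-nonempty D ke)
  Dead⇒unique d (right D ∷ S) [] ke ve = ⊥-elim (key-nonempty D ke)
  Dead⇒unique d (left {k} {l} D ∷ S) (left D′ ∷ T) ke ve with domino-unique D D′ ke
  ... | ≡.refl = cong (_ ∷_) (Dead⇒unique d S T (++-cancelˡ k _ _ ke) (++-cancelˡ l _ _ ve))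
  Dead⇒unique d (right {k} {r = r} D ∷ S) (right D′ ∷ T) ke ve with domino-unique D D′ ke
  ... | ≡.refl = cong (_ ∷_) (Dead⇒unique d S T (++-cancelˡ k _ _ ke) (++-cancelˡ r _ _ ve))
  Dead⇒unique d (left {k} D ∷ S) (right D′ ∷ T) ke ve with domino-unique D D′ ke
  ... | ≡.refl = ⊥-elim (left-right-apart d D S T (++-cancelˡ k _ _ ke) ve)
  Dead⇒unique d (right {k} D ∷ S) (left D′ ∷ T) ke ve with domino-unique D D′ ke
  ... | ≡.refl = ⊥-elim (left-right-apart d D T S (≡.sym (++-cancelˡ k _ _ ke)) (≡.sym ve))

  -- Each step of the run contributes both tiles of its rule, so the keys agree and the left side
  -- stays ahead by the queue. The tiles of `finalD` let the right side catch up.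
  ⇝*-match : ∀ {q} → q ⇝* final → ∃₂ λ ss tt → All IsTile ss × All IsTile tt ×
             keys ss ≡ keys tt × sepBefore q ++ vals ss ≡ sep ∷ vals tt
  ⇝*-match [] = _ , _ , left finalD ∷ [] , right finalD ∷ [] , ≡.refl , e
    where
    e : sepBefore final ++ sep ∷ end ∷ [] ≡ sep ∷ (sepAfter final ++ end ∷ []) ++ []
    e = ≡.trans (≡.sym (sep-shift final (end ∷ []))) (cong (sep ∷_) (≡.sym (++-identityʳ _)))
  ⇝*-match (_∷⟨_⟩_ {u} {v} ρ r p) with ⇝*-match p
  ... | ss , tt , S , T , ke , ve =
    _ , _ , left (ruleD ρ) ∷ S , right (ruleD ρ) ∷ T , cong (map tape u ++_) ke , (begin
      sepBefore (u ++ r) ++ sepBefore v ++ vals ss        ≡⟨ cong (_++ _) (sepBefore-++ u r) ⟩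
      (sepBefore u ++ sepBefore r) ++ sepBefore v ++ vals ss ≡⟨ ++-assoc (sepBefore u) _ _ ⟩
      sepBefore u ++ sepBefore r ++ sepBefore v ++ vals ss ≡⟨ cong (sepBefore u ++_) (++-assoc (sepBefore r) _ _) ⟨
      sepBefore u ++ (sepBefore r ++ sepBefore v) ++ vals ss ≡⟨ cong (λ w → sepBefore u ++ w ++ vals ss) (sepBefore-++ r v) ⟨
      sepBefore u ++ sepBefore (r ++ v) ++ vals ss         ≡⟨ cong (sepBefore u ++_) ve ⟩
      sepBefore u ++ sep ∷ vals tt                          ≡⟨ sep-shift u (vals tt) ⟨
      sep ∷ sepAfter u ++ vals tt                           ∎)
    where open ≡-Reasoning

-- Loop programs

-- loop r P repeats P as long as register r is positive, decrementing r before each round.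
data Prog : Set where
  skip : Prog
  inc  : ℕ → Prog
  _⨾_  : Prog → Prog → Prog
  loop : ℕ → Prog → Prog

infixr 5 _⨾_

-- A store is a list of registers, each with as many occurrences as its value.
Store : Set
Store = List ℕ

infix 8 _⟨_⟩
_⟨_⟩ : Store → ℕ → ℕ
[] ⟨ r ⟩ = 0
(x ∷ M) ⟨ r ⟩ with x ≟ r
... | yes _ = suc (M ⟨ r ⟩)
... | no _ = M ⟨ r ⟩

-- Insertion is at the front and `next` removes the first occurrence, just as the queue machine
-- does, so the simulation keeps stores equal as lists.
data Exec : Prog → Store → Store → Set where
  skip : ∀ {M} → Exec skip M M
  inc  : ∀ {r M} → Exec (inc r) M (r ∷ M)
  _⨾_  : ∀ {P Q M M′ M″} → Exec P M M′ → Exec Q M′ M″ → Exec (P ⨾ Q) M M″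
  exit : ∀ {r P M} → M ⟨ r ⟩ ≡ 0 → Exec (loop r P) M M
  next : ∀ {r P M M′} A C → A ⟨ r ⟩ ≡ 0 → Exec P (A ++ C) M → Exec (loop r P) M M′ →
         Exec (loop r P) (A ++ r ∷ C) M′

⟨⟩-here : ∀ r M → (r ∷ M) ⟨ r ⟩ ≡ suc (M ⟨ r ⟩)
⟨⟩-here r M with r ≟ r
... | yes _ = ≡.refl
... | no r≢r = ⊥-elim (r≢r ≡.refl)

⟨⟩-there : ∀ {r x} M → r ≢ x → (x ∷ M) ⟨ r ⟩ ≡ M ⟨ r ⟩
⟨⟩-there {r} {x} M r≢x with x ≟ r
... | yes x≡r = ⊥-elim (r≢x (≡.sym x≡r))
... | no _ = ≡.refl

⟨⟩-++ : ∀ A C r → (A ++ C) ⟨ r ⟩ ≡ A ⟨ r ⟩ + C ⟨ r ⟩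
⟨⟩-++ [] C r = ≡.refl
⟨⟩-++ (x ∷ A) C r with x ≟ r
... | yes _ = cong suc (⟨⟩-++ A C r)
... | no _ = ⟨⟩-++ A C r

split : ∀ r M {n} → M ⟨ r ⟩ ≡ suc n → ∃₂ λ A C → M ≡ A ++ r ∷ C × A ⟨ r ⟩ ≡ 0
split r (x ∷ M) e with x ≟ r
... | yes ≡.refl = [] , M , ≡.refl , ≡.refl
... | no x≢r with split r M e
...   | A , C , ≡.refl , e′ = x ∷ A , C , ≡.refl , ≡.trans (⟨⟩-there A (x≢r ∘ ≡.sym)) e′

-- This hides which occurrence is removed: the correctness of programs is argued in register values
-- alone.
next′ : ∀ {r P M n} → M ⟨ r ⟩ ≡ suc n → ∃ λ N → N ⟨ r ⟩ ≡ n × (∀ {q} → q ≢ r → N ⟨ q ⟩ ≡ M ⟨ q ⟩) ×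
        (∀ {N′ M′} → Exec P N N′ → Exec (loop r P) N′ M′ → Exec (loop r P) M M′)
next′ {r} {P} {M} {n} e with split r M e
... | A , C , ≡.refl , A≡0 = A ++ C , dec , other , next A C A≡0
  where
  open ≡-Reasoning
  dec : (A ++ C) ⟨ r ⟩ ≡ n
  dec = suc-injective (begin
    suc ((A ++ C) ⟨ r ⟩)          ≡⟨ cong suc (⟨⟩-++ A C r) ⟩
    suc (A ⟨ r ⟩ + C ⟨ r ⟩)       ≡⟨ +-suc (A ⟨ r ⟩) _ ⟨
    A ⟨ r ⟩ + suc (C ⟨ r ⟩)       ≡⟨ cong (A ⟨ r ⟩ +_) (⟨⟩-here r C) ⟨
    A ⟨ r ⟩ + (r ∷ C) ⟨ r ⟩       ≡⟨ ⟨⟩-++ A (r ∷ C) r ⟨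
    (A ++ r ∷ C) ⟨ r ⟩            ≡⟨ e ⟩
    suc n                         ∎)
  other : ∀ {q} → q ≢ r → (A ++ C) ⟨ q ⟩ ≡ (A ++ r ∷ C) ⟨ q ⟩
  other {q} q≢r = begin
    (A ++ C) ⟨ q ⟩           ≡⟨ ⟨⟩-++ A C q ⟩
    A ⟨ q ⟩ + C ⟨ q ⟩        ≡⟨ cong (A ⟨ q ⟩ +_) (⟨⟩-there C q≢r) ⟨
    A ⟨ q ⟩ + (r ∷ C) ⟨ q ⟩  ≡⟨ ⟨⟩-++ A (r ∷ C) q ⟨
    (A ++ r ∷ C) ⟨ q ⟩       ∎

infix 4 _≈[_]_
_≈[_]_ : Store → ℕ → Store → Set
M ≈[ k ] M′ = ∀ {r} → r < k → M′ ⟨ r ⟩ ≡ M ⟨ r ⟩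

≈-trans : ∀ {k M M′ M″} → M ≈[ k ] M′ → M′ ≈[ k ] M″ → M ≈[ k ] M″
≈-trans p q r<k = ≡.trans (q r<k) (p r<k)

≈-weaken : ∀ {k k′ M M′} → k ≤ k′ → M ≈[ k′ ] M′ → M ≈[ k ] M′
≈-weaken k≤k′ p r<k = p (<-≤-trans r<k k≤k′)

clear : ℕ → Prog
clear k = loop k skip

clear-exec : ∀ k M → ∃ λ M′ → Exec (clear k) M M′ × M′ ⟨ k ⟩ ≡ 0 × (∀ {r} → r ≢ k → M′ ⟨ r ⟩ ≡ M ⟨ r ⟩)
clear-exec k M = go (M ⟨ k ⟩) M ≡.refl
  where
  go : ∀ n M → M ⟨ k ⟩ ≡ n →
       ∃ λ M′ → Exec (clear k) M M′ × M′ ⟨ k ⟩ ≡ 0 × (∀ {r} → r ≢ k → M′ ⟨ r ⟩ ≡ M ⟨ r ⟩)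
  go zero M e = M , exit e , e , λ _ → ≡.refl
  go (suc n) M e =
    let N , N⟨k⟩ , N≈ , cont = next′ {P = skip} {M = M} e
        M′ , ex , M′⟨k⟩ , M′≈ = go n N N⟨k⟩
    in M′ , cont skip ex , M′⟨k⟩ , λ r≢k → ≡.trans (M′≈ r≢k) (N≈ r≢k)

pour : ℕ → ℕ → Prog
pour a b = loop a (inc b)

pour-exec : ∀ {a b} → a ≢ b → ∀ M → ∃ λ M′ → Exec (pour a b) M M′ ×
            M′ ⟨ b ⟩ ≡ M ⟨ a ⟩ + M ⟨ b ⟩ × (∀ {r} → r ≢ a → r ≢ b → M′ ⟨ r ⟩ ≡ M ⟨ r ⟩)
pour-exec {a} {b} a≢b M = go (M ⟨ a ⟩) M ≡.refl
  where
  go : ∀ n M → M ⟨ a ⟩ ≡ n → ∃ λ M′ → Exec (pour a b) M M′ ×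
       M′ ⟨ b ⟩ ≡ n + M ⟨ b ⟩ × (∀ {r} → r ≢ a → r ≢ b → M′ ⟨ r ⟩ ≡ M ⟨ r ⟩)
  go zero M e = M , exit e , ≡.refl , λ _ _ → ≡.refl
  go (suc n) M e =
    let N , N⟨a⟩ , N≈ , cont = next′ {P = inc b} {M = M} e
        M′ , ex , M′⟨b⟩ , M′≈ = go n (b ∷ N) (≡.trans (⟨⟩-there N a≢b) N⟨a⟩)
    in M′ , cont inc ex ,
       ≡.trans M′⟨b⟩ (≡.trans (cong (n +_) (≡.trans (⟨⟩-here b N) (cong suc (N≈ (a≢b ∘ ≡.sym))))) (+-suc n _)) ,
       λ r≢a r≢b → ≡.trans (M′≈ r≢a r≢b) (≡.trans (⟨⟩-there N r≢b) (N≈ r≢a))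

pour₂ : ℕ → ℕ → ℕ → Prog
pour₂ a b c = loop a (inc b ⨾ inc c)

pour₂-exec : ∀ {a b c} → a ≢ b → a ≢ c → b ≢ c → ∀ M → ∃ λ M′ → Exec (pour₂ a b c) M M′ × M′ ⟨ a ⟩ ≡ 0 ×
             M′ ⟨ b ⟩ ≡ M ⟨ a ⟩ + M ⟨ b ⟩ × M′ ⟨ c ⟩ ≡ M ⟨ a ⟩ + M ⟨ c ⟩ ×
             (∀ {r} → r ≢ a → r ≢ b → r ≢ c → M′ ⟨ r ⟩ ≡ M ⟨ r ⟩)
pour₂-exec {a} {b} {c} a≢b a≢c b≢c M = go (M ⟨ a ⟩) M ≡.refl
  where
  go : ∀ n M → M ⟨ a ⟩ ≡ n → ∃ λ M′ → Exec (pour₂ a b c) M M′ × M′ ⟨ a ⟩ ≡ 0 ×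
       M′ ⟨ b ⟩ ≡ n + M ⟨ b ⟩ × M′ ⟨ c ⟩ ≡ n + M ⟨ c ⟩ ×
       (∀ {r} → r ≢ a → r ≢ b → r ≢ c → M′ ⟨ r ⟩ ≡ M ⟨ r ⟩)
  go zero M e = M , exit e , e , ≡.refl , ≡.refl , λ _ _ _ → ≡.refl
  go (suc n) M e =
    let N , N⟨a⟩ , N≈ , cont = next′ {P = inc b ⨾ inc c} {M = M} e
        M′ , ex , M′⟨a⟩ , M′⟨b⟩ , M′⟨c⟩ , M′≈ = go n (c ∷ b ∷ N)
          (≡.trans (⟨⟩-there (b ∷ N) a≢c) (≡.trans (⟨⟩-there N a≢b) N⟨a⟩))
    in M′ , cont (inc ⨾ inc) ex , M′⟨a⟩ ,
       ≡.trans M′⟨b⟩ (≡.trans (cong (n +_) (≡.trans (⟨⟩-there (b ∷ N) b≢c)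
         (≡.trans (⟨⟩-here b N) (cong suc (N≈ (a≢b ∘ ≡.sym)))))) (+-suc n _)) ,
       ≡.trans M′⟨c⟩ (≡.trans (cong (n +_) (≡.trans (⟨⟩-here c (b ∷ N))
         (cong suc (≡.trans (⟨⟩-there N (b≢c ∘ ≡.sym)) (N≈ (a≢c ∘ ≡.sym)))))) (+-suc n _)) ,
       λ r≢a r≢b r≢c → ≡.trans (M′≈ r≢a r≢b r≢c) (≡.trans (⟨⟩-there (b ∷ N) r≢c)
         (≡.trans (⟨⟩-there N r≢b) (N≈ r≢a)))

move : ℕ → ℕ → Prog
move a k = clear k ⨾ pour a k

move-exec : ∀ {a k} → k < a → ∀ M → ∃ λ M′ → Exec (move a k) M M′ × M′ ⟨ k ⟩ ≡ M ⟨ a ⟩ ×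
            (∀ {r} → r ≢ a → r ≢ k → M′ ⟨ r ⟩ ≡ M ⟨ r ⟩)
move-exec {a} {k} k<a M =
  let M₁ , ex₁ , M₁⟨k⟩ , M₁≈ = clear-exec k M
      M₂ , ex₂ , M₂⟨k⟩ , M₂≈ = pour-exec (>⇒≢ k<a) M₁
  in M₂ , ex₁ ⨾ ex₂ , ≡.trans M₂⟨k⟩ (≡.trans (cong₂ _+_ (M₁≈ (>⇒≢ k<a)) M₁⟨k⟩) (+-identityʳ _)) ,
     λ r≢a r≢k → ≡.trans (M₂≈ r≢a r≢k) (M₁≈ r≢k)

-- As `pour₂` empties `a`, a second copy in `suc k` is made to be poured back.
copy : ℕ → ℕ → Prog
copy a k = clear k ⨾ clear (suc k) ⨾ pour₂ a k (suc k) ⨾ pour (suc k) a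

copy-exec : ∀ {a k} → a < k → ∀ M → ∃ λ M′ → Exec (copy a k) M M′ × M′ ⟨ k ⟩ ≡ M ⟨ a ⟩ × M ≈[ k ] M′
copy-exec {a} {k} a<k M =
  let M₁ , ex₁ , M₁⟨k⟩ , M₁≈ = clear-exec k M
      M₂ , ex₂ , M₂⟨k′⟩ , M₂≈ = clear-exec (suc k) M₁
      M₃ , ex₃ , M₃⟨a⟩ , M₃⟨k⟩ , M₃⟨k′⟩ , M₃≈ = pour₂-exec a≢k a≢k′ k≢k′ M₂
      M₄ , ex₄ , M₄⟨a⟩ , M₄≈ = pour-exec (a≢k′ ∘ ≡.sym) M₃
      M₂⟨a⟩ = ≡.trans (M₂≈ a≢k′) (M₁≈ a≢k)
      M₄⟨a⟩′ = ≡.trans M₄⟨a⟩ (≡.trans (cong₂ _+_ (≡.trans M₃⟨k′⟩ (cong₂ _+_ M₂⟨a⟩ M₂⟨k′⟩)) M₃⟨a⟩)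
                 (≡.trans (+-identityʳ _) (+-identityʳ _)))
  in M₄ , ex₁ ⨾ ex₂ ⨾ ex₃ ⨾ ex₄ ,
     ≡.trans (M₄≈ k≢k′ (a≢k ∘ ≡.sym)) (≡.trans M₃⟨k⟩
       (≡.trans (cong₂ _+_ M₂⟨a⟩ (≡.trans (M₂≈ k≢k′) M₁⟨k⟩)) (+-identityʳ _))) ,
     below M₁ M₂ M₃ M₄ M₁≈ M₂≈ M₃≈ M₄≈ M₄⟨a⟩′
  where
  a≢k : a ≢ k
  a≢k = <⇒≢ a<k
  a≢k′ : a ≢ suc k
  a≢k′ = <⇒≢ (m<n⇒m<1+n a<k)
  k≢k′ : k ≢ suc k
  k≢k′ = <⇒≢ (n<1+n k)
  below : ∀ M₁ M₂ M₃ M₄ → (∀ {r} → r ≢ k → M₁ ⟨ r ⟩ ≡ M ⟨ r ⟩) → (∀ {r} → r ≢ suc k → M₂ ⟨ r ⟩ ≡ M₁ ⟨ r ⟩) →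
          (∀ {r} → r ≢ a → r ≢ k → r ≢ suc k → M₃ ⟨ r ⟩ ≡ M₂ ⟨ r ⟩) →
          (∀ {r} → r ≢ suc k → r ≢ a → M₄ ⟨ r ⟩ ≡ M₃ ⟨ r ⟩) → M₄ ⟨ a ⟩ ≡ M ⟨ a ⟩ → M ≈[ k ] M₄
  below M₁ M₂ M₃ M₄ e₁ e₂ e₃ e₄ ea {r} r<k with r ≟ a
  ... | yes ≡.refl = ea
  ... | no r≢a = ≡.trans (e₄ r≢k′ r≢a) (≡.trans (e₃ r≢a r≢k r≢k′) (≡.trans (e₂ r≢k′) (e₁ r≢k)))
    where
    r≢k : r ≢ k
    r≢k = <⇒≢ r<k
    r≢k′ : r ≢ suc k
    r≢k′ = <⇒≢ (m<n⇒m<1+n r<k)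

-- Compiling recursive functions

range : ∀ m → ℕ → Vec ℕ m
range zero k = []
range (suc m) k = k ∷ range m (suc k)

-- compile f as k computes f at the values of the registers as, which are below k, into register k.
-- Registers above k are scratch space whose initial contents do not matter.
compile  : ∀ {n} → PRF n → Vec ℕ n → ℕ → Prog
compile* : ∀ {m n} → Vec (PRF n) m → Vec ℕ n → ℕ → Prog

-- Register `k` holds the value so far, `1 + k` the recursion index, `2 + k` the rounds left and
-- `3 + k` the new value.
recBody : ∀ {n} → PRF (2 + n) → Vec ℕ n → ℕ → Prog
recBody g as k = compile g (1 + k ∷ k ∷ as) (3 + k) ⨾ move (3 + k) k ⨾ inc (1 + k)

-- Register `k` holds the candidate and `1 + k` the value of `f` there, so the loop ends at a zero.
-- What its decrement leaves behind is overwritten.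
muBody : ∀ {n} → PRF (1 + n) → Vec ℕ n → ℕ → Prog
muBody f as k = inc k ⨾ compile f (k ∷ as) (1 + k)

compile zeroF as k = clear k
compile succF (a ∷ []) k = copy a k ⨾ inc k
compile (projF i) as k = copy (Vec.lookup as i) k
compile (compF {m} f gs) as k =
  compile* gs as (suc k) ⨾ compile f (range m (suc k)) (m + suc k) ⨾ move (m + suc k) k
compile (recF f g) (a ∷ as) k = compile f as k ⨾ clear (1 + k) ⨾ copy a (2 + k) ⨾ loop (2 + k) (recBody g as k)
compile (muF f) as k = clear k ⨾ compile f (k ∷ as) (1 + k) ⨾ loop (1 + k) (muBody f as k)

compile* [] as k = skip
compile* (g ∷ gs) as k = compile g as k ⨾ compile* gs as (suc k)

values : ∀ {n} → Store → Vec ℕ n → Vec ℕ n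
values M = Vec.map (M ⟨_⟩)

Computes : (P : Prog) (k y : ℕ) (M : Store) → Set
Computes P k y M = ∃ λ M′ → Exec P M M′ × M′ ⟨ k ⟩ ≡ y × M ≈[ k ] M′

Correct : ∀ {n} → PRF n → Set
Correct f = ∀ {xs y} → f ⟦ xs ⟧⇓ y → ∀ {as k} M → VecAll.All (_< k) as → values M as ≡ xs →
            Computes (compile f as k) k y M

Correct* : ∀ {m n} → Vec (PRF n) m → Set
Correct* {m} gs = ∀ {xs ys} → gs ⟦ xs ⟧⇓* ys → ∀ {as k} M → VecAll.All (_< k) as → values M as ≡ xs →
                  ∃ λ M′ → Exec (compile* gs as k) M M′ × values M′ (range m k) ≡ ys × M ≈[ k ] M′

values-≈ : ∀ {n k} M M′ {as : Vec ℕ n} → VecAll.All (_< k) as → M ≈[ k ] M′ → values M′ as ≡ values M as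
values-≈ M M′ [] e = ≡.refl
values-≈ M M′ (a<k ∷ as<k) e = cong₂ _∷_ (e a<k) (values-≈ M M′ as<k e)

range-< : ∀ m k → VecAll.All (_< m + k) (range m k)
range-< zero k = []
range-< (suc m) k = s≤s (m≤n+m k m) ∷ subst (λ j → VecAll.All (_< j) (range m (suc k))) (+-suc m k) (range-< m (suc k))

below-weaken : ∀ {n k k′} {as : Vec ℕ n} → k ≤ k′ → VecAll.All (_< k) as → VecAll.All (_< k′) as
below-weaken k≤k′ = VecAll.map (λ a<k → <-≤-trans a<k k≤k′)

-- The derivation for `suc x` contains that for `x`, so the induction describes the store after the
-- first `x` rounds and leaves the other `rem` rounds to a continuation.
rec-run : ∀ {n} (f : PRF n) g → Correct f → Correct g → ∀ {xs x y} → recF f g ⟦ x ∷ xs ⟧⇓ y →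
          ∀ {a as k} M rem → a < k → VecAll.All (_< k) as → values M as ≡ xs → M ⟨ a ⟩ ≡ x + rem →
          ∃ λ N → (∀ {M′} → Exec (loop (2 + k) (recBody g as k)) N M′ → Exec (compile (recF f g) (a ∷ as) k) M M′) ×
          N ⟨ k ⟩ ≡ y × N ⟨ 1 + k ⟩ ≡ x × N ⟨ 2 + k ⟩ ≡ rem × M ≈[ k ] N
rec-run f g cf cg (ev-rec0 d) {a} {as} {k} M rem a<k as<k M-as M⟨a⟩ =
  let M₁ , ex₁ , M₁⟨k⟩ , M₁≈ = cf d M as<k M-as
      M₂ , ex₂ , M₂⟨1+k⟩ , M₂≈ = clear-exec (1 + k) M₁
      M₃ , ex₃ , M₃⟨2+k⟩ , M₃≈ = copy-exec {a} {2 + k} (m<n⇒m<1+n (m<n⇒m<1+n a<k)) M₂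
  in M₃ , (λ ex → ex₁ ⨾ ex₂ ⨾ ex₃ ⨾ ex) ,
     ≡.trans (M₃≈ (m<n⇒m<1+n (n<1+n k))) (≡.trans (M₂≈ (<⇒≢ (n<1+n k))) M₁⟨k⟩) ,
     ≡.trans (M₃≈ (n<1+n (1 + k))) M₂⟨1+k⟩ ,
     ≡.trans M₃⟨2+k⟩ (≡.trans (M₂≈ (<⇒≢ (m<n⇒m<1+n a<k))) (≡.trans (M₁≈ a<k) M⟨a⟩)) ,
     λ r<k → ≡.trans (M₃≈ (m<n⇒m<1+n (m<n⇒m<1+n r<k))) (≡.trans (M₂≈ (<⇒≢ (m<n⇒m<1+n r<k))) (M₁≈ r<k))
rec-run f g cf cg (ev-recS {k = x} d e) {a} {as} {k} M rem a<k as<k M-as M⟨a⟩ =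
  let N , cont , N⟨k⟩ , N⟨1+k⟩ , N⟨2+k⟩ , N≈ =
        rec-run f g cf cg d M (suc rem) a<k as<k M-as (≡.trans M⟨a⟩ (≡.sym (+-suc x rem)))
      N₁ , N₁⟨2+k⟩ , N₁≈ , cont₁ = next′ {P = recBody g as k} {M = N} N⟨2+k⟩
      N₁≈N : N ≈[ 2 + k ] N₁
      N₁≈N = λ r< → N₁≈ (<⇒≢ r<)
      M-as′ = ≡.trans (values-≈ M N₁ as<k (≈-trans {M = M} {N} {N₁} N≈ (≈-weaken {M = N} {N₁} (m≤n+m k 2) N₁≈N))) M-as
      N₂ , ex₂ , N₂⟨3+k⟩ , N₂≈ = cg e {1 + k ∷ k ∷ as} {3 + k} N₁
        (m<n⇒m<1+n (n<1+n (1 + k)) ∷ m<n⇒m<1+n (m<n⇒m<1+n (n<1+n k)) ∷ below-weaken (m≤n+m k 3) as<k)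
        (cong₂ _∷_ (≡.trans (N₁≈N (n<1+n (1 + k))) N⟨1+k⟩)
          (cong₂ _∷_ (≡.trans (N₁≈N (m<n⇒m<1+n (n<1+n k))) N⟨k⟩) M-as′))
      N₃ , ex₃ , N₃⟨k⟩ , N₃≈ = move-exec {3 + k} {k} (m<n⇒m<1+n (m<n⇒m<1+n (n<1+n k))) N₂
  in (1 + k) ∷ N₃ , (λ ex → cont (cont₁ (ex₂ ⨾ ex₃ ⨾ inc) ex)) ,
     ≡.trans (⟨⟩-there N₃ (<⇒≢ (n<1+n k))) (≡.trans N₃⟨k⟩ N₂⟨3+k⟩) ,
     ≡.trans (⟨⟩-here (1 + k) N₃) (cong suc (≡.trans (N₃≈ (<⇒≢ (m<n⇒m<1+n (n<1+n (1 + k)))) (>⇒≢ (n<1+n k)))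
       (≡.trans (N₂≈ (m<n⇒m<1+n (n<1+n (1 + k)))) (≡.trans (N₁≈N (n<1+n (1 + k))) N⟨1+k⟩)))) ,
     ≡.trans (⟨⟩-there N₃ (>⇒≢ (n<1+n (1 + k)))) (≡.trans (N₃≈ (<⇒≢ (n<1+n (2 + k))) (>⇒≢ (m<n⇒m<1+n (n<1+n k))))
       (≡.trans (N₂≈ (n<1+n (2 + k))) N₁⟨2+k⟩)) ,
     λ r<k → ≡.trans (⟨⟩-there N₃ (<⇒≢ (m<n⇒m<1+n r<k)))
       (≡.trans (N₃≈ (<⇒≢ (m<n⇒m<1+n (m<n⇒m<1+n (m<n⇒m<1+n r<k)))) (<⇒≢ r<k))
       (≡.trans (N₂≈ (m<n⇒m<1+n (m<n⇒m<1+n (m<n⇒m<1+n r<k))))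
       (≡.trans (N₁≈N (m<n⇒m<1+n (m<n⇒m<1+n r<k))) (N≈ r<k))))

-- Induction on the distance `rem` from the candidate to `y`. Evaluation and loop are separate
-- results because the evaluation for the next candidate belongs to the body of the current round.
mu-run : ∀ {n} (f : PRF (suc n)) → Correct f → ∀ {xs y} → f ⟦ y ∷ xs ⟧⇓ 0 →
         (∀ z → z < y → ∃ λ v → f ⟦ z ∷ xs ⟧⇓ suc v) →
         ∀ rem {z as k} M → z + rem ≡ y → VecAll.All (_< k) as → values M as ≡ xs → M ⟨ k ⟩ ≡ z →
         ∃₂ λ N M′ → Exec (compile f (k ∷ as) (1 + k)) M N × Exec (loop (1 + k) (muBody f as k)) N M′ ×
         M′ ⟨ k ⟩ ≡ y × M ≈[ k ] M′
mu-run f cf d below zero {z} {as} {k} M z≡y as<k M-as M⟨k⟩ =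
  let z≡y′ = ≡.trans (≡.sym (+-identityʳ z)) z≡y
      N , ex , N⟨1+k⟩ , N≈ = cf d {k ∷ as} {1 + k} M (n<1+n k ∷ below-weaken (n≤1+n k) as<k)
        (cong₂ _∷_ (≡.trans M⟨k⟩ z≡y′) M-as)
  in N , N , ex , exit N⟨1+k⟩ , ≡.trans (N≈ (n<1+n k)) (≡.trans M⟨k⟩ z≡y′) , λ r<k → N≈ (m<n⇒m<1+n r<k)
mu-run f cf {y = y} d below (suc rem) {z} {as} {k} M z≡y as<k M-as M⟨k⟩ =
  let z<y = subst (z <_) z≡y (m<m+n z (s≤s z≤n))
      N , ex , N⟨1+k⟩ , N≈ = cf (proj₂ (below z z<y)) {k ∷ as} {1 + k} M (n<1+n k ∷ below-weaken (n≤1+n k) as<k)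
        (cong₂ _∷_ M⟨k⟩ M-as)
      N₁ , _ , N₁≈ , cont = next′ {P = muBody f as k} {M = N} N⟨1+k⟩
      M₂≈ : M ≈[ k ] (k ∷ N₁)
      M₂≈ = λ r<k → ≡.trans (⟨⟩-there N₁ (<⇒≢ r<k)) (≡.trans (N₁≈ (<⇒≢ (m<n⇒m<1+n r<k))) (N≈ (m<n⇒m<1+n r<k)))
      N₂ , M′ , ex₂ , ex′ , M′⟨k⟩ , M′≈ = mu-run f cf d below rem {suc z} {as} {k} (k ∷ N₁)
        (≡.trans (≡.sym (+-suc z rem)) z≡y) as<k (≡.trans (values-≈ M (k ∷ N₁) as<k M₂≈) M-as)
        (≡.trans (⟨⟩-here k N₁) (cong suc (≡.trans (N₁≈ (<⇒≢ (n<1+n k))) (≡.trans (N≈ (n<1+n k)) M⟨k⟩))))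
  in N , M′ , ex , cont (inc ⨾ ex₂) ex′ , M′⟨k⟩ , λ r<k → ≡.trans (M′≈ r<k) (M₂≈ r<k)

correct  : ∀ {n} (f : PRF n) → Correct f
correct* : ∀ {m n} (gs : Vec (PRF n) m) → Correct* gs

correct zeroF ev-zero {k = k} M as<k M-as =
  let M′ , ex , M′⟨k⟩ , M′≈ = clear-exec k M in M′ , ex , M′⟨k⟩ , λ r<k → M′≈ (<⇒≢ r<k)
correct succF ev-succ {a ∷ []} {k} M (a<k ∷ []) ≡.refl =
  let M′ , ex , M′⟨k⟩ , M′≈ = copy-exec a<k M
  in k ∷ M′ , ex ⨾ inc , ≡.trans (⟨⟩-here k M′) (cong suc M′⟨k⟩) ,
     λ r<k → ≡.trans (⟨⟩-there M′ (<⇒≢ r<k)) (M′≈ r<k)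
correct (projF i) ev-proj {as} {k} M as<k ≡.refl =
  let M′ , ex , M′⟨k⟩ , M′≈ = copy-exec (lookup⁺ as<k i) M
  in M′ , ex , ≡.trans M′⟨k⟩ (≡.sym (lookup-map i (M ⟨_⟩) as)) , M′≈
correct (compF {m} f gs) (ev-comp ds d) {as} {k} M as<k M-as =
  let M₁ , ex₁ , M₁-ys , M₁≈ = correct* gs ds M (below-weaken (n≤1+n k) as<k) M-as
      M₂ , ex₂ , M₂⟨⟩ , M₂≈ = correct f d M₁ (range-< m (suc k)) M₁-ys
      M₃ , ex₃ , M₃⟨k⟩ , M₃≈ = move-exec {m + suc k} {k} (m≤n+m (suc k) m) M₂
  in M₃ , ex₁ ⨾ ex₂ ⨾ ex₃ , ≡.trans M₃⟨k⟩ M₂⟨⟩ ,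
     λ {r} r<k → let r<k′ = <-≤-trans (m<n⇒m<1+n r<k) (m≤n+m (suc k) m) in
       ≡.trans (M₃≈ (<⇒≢ r<k′) (<⇒≢ r<k)) (≡.trans (M₂≈ r<k′) (M₁≈ (m<n⇒m<1+n r<k)))
correct (recF f g) {xs = x ∷ _} d {a ∷ as} {k} M (a<k ∷ as<k) ≡.refl =
  let N , cont , N⟨k⟩ , _ , N⟨2+k⟩ , N≈ =
        rec-run f g (correct f) (correct g) d {a} {as} {k} M 0 a<k as<k ≡.refl (≡.sym (+-identityʳ x))
  in N , cont (exit N⟨2+k⟩) , N⟨k⟩ , N≈
correct (muF f) {y = y} (ev-mu d below) {as} {k} M as<k M-as =
  let M₁ , ex₁ , M₁⟨k⟩ , M₁≈ = clear-exec k M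
      M₁≈M : M ≈[ k ] M₁
      M₁≈M = λ r<k → M₁≈ (<⇒≢ r<k)
      N , M′ , ex₂ , ex₃ , M′⟨k⟩ , M′≈ = mu-run f (correct f) d below y M₁ ≡.refl as<k
        (≡.trans (values-≈ M M₁ as<k M₁≈M) M-as) M₁⟨k⟩
  in M′ , ex₁ ⨾ ex₂ ⨾ ex₃ , M′⟨k⟩ , ≈-trans {M = M} {M₁} {M′} M₁≈M M′≈

correct* [] [] M as<k M-as = M , skip , ≡.refl , λ _ → ≡.refl
correct* (g ∷ gs) (d ∷ ds) {as} {k} M as<k M-as =
  let M₁ , ex₁ , M₁⟨k⟩ , M₁≈ = correct g d M as<k M-as
      M₂ , ex₂ , M₂-ys , M₂≈ = correct* gs ds M₁ (below-weaken (n≤1+n k) as<k)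
        (≡.trans (values-≈ M M₁ as<k M₁≈) M-as)
  in M₂ , ex₁ ⨾ ex₂ , cong₂ _∷_ (≡.trans (M₂≈ (n<1+n k)) M₁⟨k⟩) M₂-ys ,
     λ r<k → ≡.trans (M₂≈ (m<n⇒m<1+n r<k)) (M₁≈ r<k)

-- From programs to queue rewriting

data Sym : Set where
  reg st : ℕ → Sym
  hash   : Sym

-- A `walk` treats the register letters one by one and changes to its exit state on reading `hash`;
-- a `write` acts at once.
data Instr : Set where
  write : List⁺ Sym → Instr
  walk  : (ℕ → List⁺ Sym) → ℕ → Instr

Code : Set
Code = List (ℕ × Instr)

seek : (r s t : ℕ) → ℕ → List⁺ Sym
seek r s t j with j ≟ r
... | yes _ = st t ∷ []
... | no _ = reg j ∷ st s ∷ []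

-- State `s` looks for `reg r` and exits to `t` if there is none. Otherwise the letter is dropped,
-- and `1 + s` walks over the rest and exits to `2 + s`.
test : (r s t : ℕ) → Code
test r s t = (s , walk (seek r s (1 + s)) t) ∷
             (1 + s , walk (λ j → reg j ∷ st (1 + s) ∷ []) (2 + s)) ∷ []

size : Prog → ℕ
size skip = 1
size (inc r) = 1
size (P ⨾ Q) = size Q + size P
size (loop r P) = size P + 2

code : Prog → (s t : ℕ) → Code
code skip s t = [ s , write (st t ∷ []) ]
code (inc r) s t = [ s , write (st t ∷ reg r ∷ []) ]
code (P ⨾ Q) s t = code P s (size P + s) ++ code Q (size P + s) t
code (loop r P) s t = test r s t ++ code P (2 + s) s

-- Codes whose source states lie in disjoint intervals can be joined without giving a state two
-- instructions; determinism of the queue system rests on this.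
record Block (a b : ℕ) (C : Code) : Set where
  field
    a≤b : a ≤ b
    within : ∀ {q i} → (q , i) ∈ C → a ≤ q × q < b
    functional : ∀ {q i j} → (q , i) ∈ C → (q , j) ∈ C → i ≡ j

open Block

single-block : ∀ q i → Block q (1 + q) [ q , i ]
single-block q i .a≤b = n≤1+n q
single-block q i .within (here ≡.refl) = ≤-refl , ≤-refl
single-block q i .functional (here ≡.refl) (here ≡.refl) = ≡.refl

++-block : ∀ {a b c C D} → Block a b C → Block b c D → Block a c (C ++ D)
++-block p q .a≤b = ≤-trans (p .a≤b) (q .a≤b)
++-block {C = C} p q .within m with ∈-++⁻ C m
... | inj₁ m′ = let l , u = p .within m′ in l , <-≤-trans u (q .a≤b)
... | inj₂ m′ = let l , u = q .within m′ in ≤-trans (p .a≤b) l , u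
++-block {C = C} p q .functional m n with ∈-++⁻ C m | ∈-++⁻ C n
... | inj₁ m′ | inj₁ n′ = p .functional m′ n′
... | inj₁ m′ | inj₂ n′ = ⊥-elim (<⇒≱ (proj₂ (p .within m′)) (proj₁ (q .within n′)))
... | inj₂ m′ | inj₁ n′ = ⊥-elim (<⇒≱ (proj₂ (p .within n′)) (proj₁ (q .within m′)))
... | inj₂ m′ | inj₂ n′ = q .functional m′ n′

test-block : ∀ r s t → Block s (2 + s) (test r s t)
test-block r s t = ++-block (single-block s _) (single-block (1 + s) _)

code-block : ∀ P s t → Block s (size P + s) (code P s t)
code-block skip s t = single-block s _
code-block (inc r) s t = single-block s _
code-block (P ⨾ Q) s t = ++-block (code-block P s _)
  (subst (λ b → Block (size P + s) b (code Q (size P + s) t)) (≡.sym (+-assoc (size Q) (size P) s)) (code-block Q (size P + s) t))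
code-block (loop r P) s t = ++-block (test-block r s t)
  (subst (λ b → Block (2 + s) b (code P (2 + s) s)) (≡.sym (+-assoc (size P) 2 s)) (code-block P (2 + s) s))

ruleList : ℕ → ℕ × Instr → List (List Sym × List Sym)
ruleList N (q , write v) = [ [ st q ] , toList v ]
ruleList N (q , walk f t) =
  (st q ∷ [ hash ] , hash ∷ [ st t ]) ∷ map (λ j → st q ∷ [ reg j ] , toList (f j)) (upTo N)

rules : ℕ → Code → List (List Sym × List Sym)
rules N C = ([ hash ] , [ hash ]) ∷ map (λ j → [ reg j ] , [ reg j ]) (upTo N) ++ concatMap (ruleList N) C

-- The bound `N` on register letters keeps the rules finite in number, so that `rules` can list
-- them; the relational form serves the case analyses.
data Rule (N : ℕ) (C : Code) : List Sym → List Sym → Set where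
  copy-hash : Rule N C [ hash ] [ hash ]
  copy-reg  : ∀ {j} → j < N → Rule N C [ reg j ] [ reg j ]
  write     : ∀ {q v} → (q , write v) ∈ C → Rule N C [ st q ] (toList v)
  walk-hash : ∀ {q f t} → (q , walk f t) ∈ C → Rule N C (st q ∷ [ hash ]) (hash ∷ [ st t ])
  walk-reg  : ∀ {q f t j} → (q , walk f t) ∈ C → j < N → Rule N C (st q ∷ [ reg j ]) (toList (f j))

∈⇒Rule : ∀ {N C u v} → (u , v) ∈ rules N C → Rule N C u v
∈⇒Rule (here ≡.refl) = copy-hash
∈⇒Rule {N} {C} (there m) with ∈-++⁻ (map (λ j → [ reg j ] , [ reg j ]) (upTo N)) m
... | inj₁ m′ with ∈-map⁻ _ m′
...   | j , j∈ , ≡.refl = copy-reg (∈-upTo⁻ j∈)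
∈⇒Rule {N} {C} (there m) | inj₂ m′ with find (∈-concatMap⁻ (ruleList N) {xs = C} m′)
...   | (q , write v) , c , here ≡.refl = write c
...   | (q , walk f t) , c , here ≡.refl = walk-hash c
...   | (q , walk f t) , c , there n with ∈-map⁻ _ n
...     | j , j∈ , ≡.refl = walk-reg c (∈-upTo⁻ j∈)

Rule⇒∈ : ∀ {N C u v} → Rule N C u v → (u , v) ∈ rules N C
Rule⇒∈ copy-hash = here ≡.refl
Rule⇒∈ (copy-reg j<N) = there (∈-++⁺ˡ (∈-map⁺ _ (∈-upTo⁺ j<N)))
Rule⇒∈ {N} (write c) = there (∈-++⁺ʳ _ (∈-concatMap⁺ (ruleList N) (lose c (here ≡.refl))))
Rule⇒∈ {N} (walk-hash c) = there (∈-++⁺ʳ _ (∈-concatMap⁺ (ruleList N) (lose c (here ≡.refl))))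
Rule⇒∈ {N} (walk-reg c j<N) =
  there (∈-++⁺ʳ _ (∈-concatMap⁺ (ruleList N) (lose c (there (∈-map⁺ _ (∈-upTo⁺ j<N))))))

Rule-deterministic : ∀ {N C} → (∀ {q i j} → (q , i) ∈ C → (q , j) ∈ C → i ≡ j) →
  ∀ {u v u′ v′} → Rule N C u v → Rule N C u′ v′ → u ~ u′ → u ≡ u′ × v ≡ v′
Rule-deterministic fun copy-hash copy-hash _ = ≡.refl , ≡.refl
Rule-deterministic fun copy-hash (copy-reg _) ()
Rule-deterministic fun copy-hash (write _) ()
Rule-deterministic fun copy-hash (walk-hash _) ()
Rule-deterministic fun copy-hash (walk-reg _ _) ()
Rule-deterministic fun (copy-reg _) copy-hash ()
Rule-deterministic fun (copy-reg _) (copy-reg _) (_ ∷ _) = ≡.refl , ≡.refl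
Rule-deterministic fun (copy-reg _) (write _) ()
Rule-deterministic fun (copy-reg _) (walk-hash _) ()
Rule-deterministic fun (copy-reg _) (walk-reg _ _) ()
Rule-deterministic fun (write c) copy-hash ()
Rule-deterministic fun (write c) (copy-reg _) ()
Rule-deterministic fun (write c) (write c′) (_ ∷ _) with fun c c′
... | ≡.refl = ≡.refl , ≡.refl
Rule-deterministic fun (write c) (walk-hash c′) (_ ∷ _) with fun c c′
... | ()
Rule-deterministic fun (write c) (walk-reg c′ _) (_ ∷ _) with fun c c′
... | ()
Rule-deterministic fun (walk-hash c) copy-hash ()
Rule-deterministic fun (walk-hash c) (copy-reg _) ()
Rule-deterministic fun (walk-hash c) (write c′) (_ ∷ _) with fun c c′
... | ()
Rule-deterministic fun (walk-hash c) (walk-hash c′) (_ ∷ _) with fun c c′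
... | ≡.refl = ≡.refl , ≡.refl
Rule-deterministic fun (walk-hash c) (walk-reg c′ _) (_ ∷ ())
Rule-deterministic fun (walk-reg c _) copy-hash ()
Rule-deterministic fun (walk-reg c _) (copy-reg _) ()
Rule-deterministic fun (walk-reg c _) (write c′) (_ ∷ _) with fun c c′
... | ()
Rule-deterministic fun (walk-reg c _) (walk-hash c′) (_ ∷ ())
Rule-deterministic fun (walk-reg c _) (walk-reg c′ _) (_ ∷ (_ ∷ _)) with fun c c′
... | ≡.refl = ≡.refl , ≡.refl

Rule-lhs-nonempty : ∀ {N C u v} → Rule N C u v → u ≢ []
Rule-lhs-nonempty copy-hash ()
Rule-lhs-nonempty (copy-reg _) ()
Rule-lhs-nonempty (write _) ()
Rule-lhs-nonempty (walk-hash _) ()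
Rule-lhs-nonempty (walk-reg _ _) ()

Rule-rhs-nonempty : ∀ {N C u v} → Rule N C u v → v ≢ []
Rule-rhs-nonempty copy-hash ()
Rule-rhs-nonempty (copy-reg _) ()
Rule-rhs-nonempty (write _) ()
Rule-rhs-nonempty (walk-hash _) ()
Rule-rhs-nonempty (walk-reg _ _) ()

Rule-state : ∀ {N C u v q w} → Rule N C u v → u ~ (st q ∷ w) → ∃ λ i → (q , i) ∈ C
Rule-state copy-hash ()
Rule-state (copy-reg _) ()
Rule-state (write c) (_ ∷ _) = _ , c
Rule-state (walk-hash c) (_ ∷ _) = _ , c
Rule-state (walk-reg c _) (_ ∷ _) = _ , c

-- Only `inc` brings letters into the store, so the counters of loops are not counted.
incBound : Prog → ℕ
incBound skip = 0
incBound (inc r) = suc r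
incBound (P ⨾ Q) = incBound P ⊔ incBound Q
incBound (loop r P) = incBound P

zero⇒All-≢ : ∀ {r} M → M ⟨ r ⟩ ≡ 0 → All (_≢ r) M
zero⇒All-≢ [] e = []
zero⇒All-≢ {r} (x ∷ M) e with x ≟ r
... | no x≢r = x≢r ∷ zero⇒All-≢ M e

-- A queue is read cyclically: the head st q stands between the registers M and A, and hash marks
-- the position to which it returns between instructions.
conf : ℕ → Store → Store → List Sym
conf q A M = st q ∷ map reg A ++ hash ∷ map reg M

module Simulation (N : ℕ) (C : Code) where
  open Queue (Rule N C)

  Bounded : Store → Set
  Bounded = All (_< N)

  infixr 4 _⟫*_
  _⟫*_ : ∀ {u v w} → u ⇝* v → v ⇝* w → u ⇝* w
  _⟫*_ = ⇝*-trans

  Copyable : Sym → Set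
  Copyable x = Rule N C [ x ] [ x ]

  regs-copyable : ∀ {M} → Bounded M → All Copyable (map reg M)
  regs-copyable b = map⁺ (All.map copy-reg b)

  body-copyable : ∀ {A M} → Bounded A → Bounded M → All Copyable (map reg A ++ hash ∷ map reg M)
  body-copyable a b = ++⁺ (regs-copyable a) (copy-hash ∷ regs-copyable b)

  -- A rule moves the head past one register letter, and copying that letter takes it to the back of
  -- the queue. The passed letters thus collect behind `hash`.
  pass : ∀ {q A} D M → Bounded A → Bounded D → Bounded M →
         All (λ a → Rule N C (st q ∷ [ reg a ]) (reg a ∷ [ st q ])) A →
         conf q (A ++ D) M ⇝* conf q D (M ++ A)
  pass {q} D M [] d m [] = subst (λ M′ → conf q D M ⇝* conf q D M′) (≡.sym (++-identityʳ M)) []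
  pass {q} {a ∷ A} D M (a<N ∷ b) d m (ρ ∷ ρs) =
    rewrite-front ρ (body-copyable (++⁺ b d) m) ⟫*
    subst (λ w → (reg a ∷ conf q (A ++ D) M) ⇝* w) e (rotate (copy-reg a<N ∷ []) (conf q (A ++ D) M)) ⟫*
    subst (λ M′ → conf q (A ++ D) (M ++ [ a ]) ⇝* conf q D M′) (++-assoc M [ a ] A)
      (pass D (M ++ [ a ]) b d (++⁺ m (a<N ∷ [])) ρs)
    where
    e : conf q (A ++ D) M ++ [ reg a ] ≡ conf q (A ++ D) (M ++ [ a ])
    e = cong (st q ∷_) (≡.trans (++-assoc (map reg (A ++ D)) (hash ∷ map reg M) [ reg a ])
          (cong (λ w → map reg (A ++ D) ++ hash ∷ w) (≡.sym (map-++ reg M [ a ]))))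

  pass-all : ∀ {q A} M → Bounded A → Bounded M →
             All (λ a → Rule N C (st q ∷ [ reg a ]) (reg a ∷ [ st q ])) A → conf q A M ⇝* conf q [] (M ++ A)
  pass-all {q} {A} M b m ρs =
    subst (λ A′ → conf q A′ M ⇝* conf q [] (M ++ A)) (++-identityʳ A) (pass [] M b [] m ρs)

  return : ∀ {q f t M} → (q , walk f t) ∈ C → Bounded M → conf q [] M ⇝* conf t M []
  return {t = t} {M} c m =
    rewrite-front (walk-hash c) (regs-copyable m) ⟫* rotate (copy-hash ∷ []) (st t ∷ map reg M)

  seek-≢ : ∀ {r s t j} → j ≢ r → seek r s t j ≡ reg j ∷ st s ∷ []
  seek-≢ {r} {j = j} j≢r with j ≟ r
  ... | yes j≡r = ⊥-elim (j≢r j≡r)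
  ... | no _ = ≡.refl

  seek-≡ : ∀ r {s t} → seek r s t r ≡ st t ∷ []
  seek-≡ r with r ≟ r
  ... | yes _ = ≡.refl
  ... | no r≢r = ⊥-elim (r≢r ≡.refl)

  seek-rules : ∀ {r s t A} → test r s t ⊆ C → A ⟨ r ⟩ ≡ 0 → Bounded A →
               All (λ a → Rule N C (st s ∷ [ reg a ]) (reg a ∷ [ st s ])) A
  seek-rules {A = A} ⊆C e b = All.zipWith
    (λ (a≢r , a<N) → subst (Rule N C _) (cong toList (seek-≢ a≢r)) (walk-reg (⊆C (here ≡.refl)) a<N))
    (zero⇒All-≢ A e , b)

  test-zero : ∀ {r s t M} → test r s t ⊆ C → Bounded M → M ⟨ r ⟩ ≡ 0 → conf s M [] ⇝* conf t M []
  test-zero ⊆C b e = pass-all [] b [] (seek-rules ⊆C e b) ⟫* return (⊆C (here ≡.refl)) b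

  test-suc : ∀ {r s t} A D → test r s t ⊆ C → Bounded (A ++ r ∷ D) → A ⟨ r ⟩ ≡ 0 →
             conf s (A ++ r ∷ D) [] ⇝* conf (2 + s) (A ++ D) []
  test-suc {r} {s} A D ⊆C b e with ++⁻ A b
  ... | bA , r<N ∷ bD =
    pass (r ∷ D) [] bA (r<N ∷ bD) [] (seek-rules ⊆C e bA) ⟫*
    rewrite-front (subst (Rule N C _) (cong toList (seek-≡ r)) (walk-reg (⊆C (here ≡.refl)) r<N))
      (body-copyable bD bA) ⟫*
    pass-all A bD bA (All.map (walk-reg (⊆C (there (here ≡.refl)))) bD) ⟫*
    return (⊆C (there (here ≡.refl))) (++⁺ bA bD)

  simulate : ∀ {P M M′} → Exec P M M′ → ∀ {s t} → code P s t ⊆ C → incBound P ≤ N → Bounded M →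
             conf s M [] ⇝* conf t M′ [] × Bounded M′
  simulate skip ⊆C _ b = rewrite-front (write (⊆C (here ≡.refl))) (body-copyable b []) , b
  simulate inc ⊆C r<N b = rewrite-front (write (⊆C (here ≡.refl))) (body-copyable b []) , r<N ∷ b
  simulate (_⨾_ {P} {Q} p q) {s} ⊆C ≤N b =
    let r₁ , b₁ = simulate p (⊆C ∘ ∈-++⁺ˡ) (m⊔n≤o⇒m≤o (incBound P) _ ≤N) b
        r₂ , b₂ = simulate q (⊆C ∘ ∈-++⁺ʳ (code P s _)) (m⊔n≤o⇒n≤o (incBound P) _ ≤N) b₁
    in (r₁ ⟫* r₂) , b₂
  simulate (exit e) ⊆C _ b = test-zero (⊆C ∘ ∈-++⁺ˡ) b e , b
  simulate (next {r} A D e p q) {s} {t} ⊆C ≤N b =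
    let bA , r∷bD = ++⁻ A b
        r₁ = test-suc A D (λ {x} → ⊆C ∘ ∈-++⁺ˡ) b e
        r₂ , b₂ = simulate p (⊆C ∘ ∈-++⁺ʳ (test r s t)) ≤N (++⁺ bA (All.tail r∷bD))
        r₃ , b₃ = simulate q ⊆C ≤N b₂
    in (r₁ ⟫* r₂ ⟫* r₃) , b₃

-- Recursive functions on codes of braids

triangle : ℕ → ℕ
triangle zero = 0
triangle (suc k) = suc k + triangle k

-- The function local to Defs.pair has no name outside; it is the solution of the underscore.
mutual
  pair-triangle : ∀ a b m → _ ≡ triangle m
  pair-triangle a b zero = ≡.refl
  pair-triangle a b (suc m) = cong (suc m +_) (pair-triangle a b m)

  pair-spec : ∀ a b → pair a b ≡ triangle (a + b) + b
  pair-spec a b with a + b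
  ... | m = cong (_+ b) (pair-triangle a b m)

constF : ∀ {n} → ℕ → PRF n
constF zero = compF zeroF []
constF (suc c) = compF succF (constF c ∷ [])

addF : PRF 2
addF = recF (projF zero) (compF succF (projF (suc zero) ∷ []))

triangleF : PRF 1
triangleF = recF zeroF (compF succF (addF′ ∷ []))
  where addF′ = compF addF (projF zero ∷ projF (suc zero) ∷ [])

pairF : PRF 2
pairF = compF addF (compF triangleF (addF ∷ []) ∷ projF (suc zero) ∷ [])

constF-⇓ : ∀ {n} c {xs} → constF {n} c ⟦ xs ⟧⇓ c
constF-⇓ zero = ev-comp [] ev-zero
constF-⇓ (suc c) = ev-comp (constF-⇓ c ∷ []) ev-succ

addF-⇓ : ∀ x y → addF ⟦ x ∷ y ∷ [] ⟧⇓ (x + y)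
addF-⇓ zero y = ev-rec0 ev-proj
addF-⇓ (suc x) y = ev-recS (addF-⇓ x y) (ev-comp (ev-proj ∷ []) ev-succ)

triangleF-⇓ : ∀ x → triangleF ⟦ x ∷ [] ⟧⇓ triangle x
triangleF-⇓ zero = ev-rec0 ev-zero
triangleF-⇓ (suc x) = ev-recS (triangleF-⇓ x)
  (ev-comp (ev-comp (ev-proj ∷ ev-proj ∷ []) (addF-⇓ x (triangle x)) ∷ []) ev-succ)

pairF-⇓ : ∀ x y → pairF ⟦ x ∷ y ∷ [] ⟧⇓ pair x y
pairF-⇓ x y = subst (pairF ⟦ x ∷ y ∷ [] ⟧⇓_) (≡.sym (pair-spec x y))
  (ev-comp (ev-comp (addF-⇓ x y ∷ []) (triangleF-⇓ (x + y)) ∷ ev-proj ∷ []) (addF-⇓ (triangle (x + y)) y))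

consF : ∀ {n} → PRF n → PRF n → PRF n
consF f g = compF succF (compF pairF (f ∷ g ∷ []) ∷ [])

consF-⇓ : ∀ {n} {f g : PRF n} {xs a b} → f ⟦ xs ⟧⇓ a → g ⟦ xs ⟧⇓ b → consF f g ⟦ xs ⟧⇓ suc (pair a b)
consF-⇓ d e = ev-comp (ev-comp (d ∷ e ∷ []) (pairF-⇓ _ _) ∷ []) ev-succ

prependF : ∀ {n} → BraidWord → PRF n → PRF n
prependF [] g = g
prependF (x ∷ w) g = consF (constF (encodeLetter x)) (prependF w g)

prependF-⇓ : ∀ {n} w {g : PRF n} {xs v} → g ⟦ xs ⟧⇓ encodeWord v → prependF w g ⟦ xs ⟧⇓ encodeWord (w ++ v)
prependF-⇓ [] d = d
prependF-⇓ (x ∷ w) d = consF-⇓ (constF-⇓ (encodeLetter x)) (prependF-⇓ w d)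

repeatF : BraidWord → BraidWord → PRF 1
repeatF block post = recF (constF (encodeWord post)) (prependF block (projF (suc zero)))

repeatF-⇓ : ∀ {block post} (W : ℕ → BraidWord) → W 0 ≡ post → (∀ n → W (suc n) ≡ block ++ W n) →
            ∀ n → repeatF block post ⟦ n ∷ [] ⟧⇓ encodeWord (W n)
repeatF-⇓ W e₀ e zero rewrite e₀ = ev-rec0 (constF-⇓ _)
repeatF-⇓ {block} W e₀ e (suc n) rewrite e n =
  ev-recS (repeatF-⇓ W e₀ e n) (prependF-⇓ block {v = W n} ev-proj)

-- The reduction

unary : ℕ → List Bool
unary zero = false ∷ []
unary (suc n) = true ∷ unary n

-- A prefix code, decoded from the front by `read`; unary indices allow for infinitely many register
-- and state letters.
bits : Ext Sym → List Bool
bits (tape (reg r)) = true ∷ true ∷ unary r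
bits (tape (st q)) = true ∷ false ∷ unary q
bits (tape hash) = false ∷ true ∷ true ∷ []
bits sep = false ∷ true ∷ false ∷ []
bits end = false ∷ false ∷ true ∷ []
bits start = false ∷ false ∷ false ∷ []

readUnary : List Bool → ℕ × List Bool
readUnary [] = 0 , []
readUnary (false ∷ w) = 0 , w
readUnary (true ∷ w) = let n , v = readUnary w in suc n , v

read : List Bool → Ext Sym × List Bool
read (true ∷ true ∷ w) = let r , v = readUnary w in tape (reg r) , v
read (true ∷ false ∷ w) = let q , v = readUnary w in tape (st q) , v
read (false ∷ true ∷ true ∷ w) = tape hash , w
read (false ∷ true ∷ false ∷ w) = sep , w
read (false ∷ false ∷ true ∷ w) = end , w
read (false ∷ false ∷ false ∷ w) = start , w
-- An arbitrary value, since no image of `bits` gets here.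
read _ = start , []

readUnary-unary : ∀ n w → readUnary (unary n ++ w) ≡ (n , w)
readUnary-unary zero w = ≡.refl
readUnary-unary (suc n) w rewrite readUnary-unary n w = ≡.refl

read-bits : ∀ a w → read (bits a ++ w) ≡ (a , w)
read-bits (tape (reg r)) w rewrite readUnary-unary r w = ≡.refl
read-bits (tape (st q)) w rewrite readUnary-unary q w = ≡.refl
read-bits (tape hash) w = ≡.refl
read-bits sep w = ≡.refl
read-bits end w = ≡.refl
read-bits start w = ≡.refl

bits-nonempty : ∀ a {w} → bits a ++ w ≢ []
bits-nonempty (tape (reg _)) ()
bits-nonempty (tape (st _)) ()
bits-nonempty (tape hash) ()
bits-nonempty sep ()
bits-nonempty end ()
bits-nonempty start ()

encode : List (Ext Sym) → List Bool
encode = concatMap bits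

encode-injective : ∀ u v → encode u ≡ encode v → u ≡ v
encode-injective [] [] e = ≡.refl
encode-injective [] (b ∷ v) e = ⊥-elim (bits-nonempty b (≡.sym e))
encode-injective (a ∷ u) [] e = ⊥-elim (bits-nonempty a e)
encode-injective (a ∷ u) (b ∷ v) e =
  let e′ = ≡.trans (≡.sym (read-bits a (encode u))) (≡.trans (cong read e) (read-bits b (encode v)))
  in cong₂ _∷_ (cong proj₁ e′) (encode-injective u v (cong proj₂ e′))

-- Opaque because evaluating the code number of a closed word would not terminate in practice.
opaque
  keyBraid valueBraid : List (Ext Sym) → BraidWord
  keyBraid k = spell xy (encode k)
  valueBraid v = spell zt (encode v)

  valueBraid-++ : ∀ u v → valueBraid (u ++ v) ≡ valueBraid u ++ valueBraid v
  valueBraid-++ u v = ≡.trans (cong (spell zt) (concatMap-++ bits u v)) (concatMap-++ zt (encode u) (encode v))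

tileBraid : List (Ext Sym) × List (Ext Sym) → BraidWord
tileBraid (k , v) = keyBraid k ++ valueBraid v

opaque
  unfolding keyBraid

  tileBraid-injective : ∀ {x y} → tileBraid x ≈B tileBraid y → x ≡ y
  tileBraid-injective {k , v} {k′ , v′} e =
    let eq = toBraid-injective {encode k} {encode v} {encode k′} {encode v′} e
    in cong₂ _,_ (encode-injective k k′ (cong proj₁ eq)) (encode-injective v v′ (cong proj₂ eq))

  prod-tileBraid : ∀ ts → prod (map tileBraid ts) ≈B tileBraid (concatMap proj₁ ts , concatMap proj₂ ts)
  prod-tileBraid [] = refl
  prod-tileBraid ((k , v) ∷ ts) =
    ≈B-congˡ (tileBraid (k , v)) (prod-tileBraid ts) ⟫
    subst (tileBraid (k , v) ++ tileBraid (keys , vals) ≈B_)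
      (cong₂ (λ p q → toBraid (p , q)) (≡.sym (concatMap-++ bits k keys)) (≡.sym (concatMap-++ bits v vals)))
      (toBraid-++ (encode k) (encode v) (encode keys) (encode vals))
    where
    keys vals : List (Ext Sym)
    keys = concatMap proj₁ ts
    vals = concatMap proj₂ ts

-- The instances and their codes

initial : ℕ → List Sym
initial n = conf 0 (replicate n 0) []

startKey : List (Ext Sym)
startKey = [ start ]

firstTile : ℕ → List (Ext Sym) × List (Ext Sym)
firstTile n = startKey , sepBefore (initial n)

-- The input enters only as the number of letters `reg 0` in the queue, so the braid is a fixed
-- beginning, a block repeated n times and a fixed end.
firstWordF : PRF 1
firstWordF = prependF (keyBraid startKey ++ valueBraid (sep ∷ tape (st 0) ∷ []))
  (repeatF (valueBraid (sep ∷ tape (reg 0) ∷ [])) (valueBraid (sep ∷ tape hash ∷ [])))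

firstWordF-⇓ : ∀ n → firstWordF ⟦ n ∷ [] ⟧⇓ encodeWord (tileBraid (firstTile n))
firstWordF-⇓ n = subst (λ w → firstWordF ⟦ n ∷ [] ⟧⇓ encodeWord w) e
  (prependF-⇓ (X ++ Y) {v = W n} (repeatF-⇓ W ≡.refl (λ m → valueBraid-++ (sep ∷ tape (reg 0) ∷ []) (tail m)) n))
  where
  tail : ℕ → List (Ext Sym)
  tail m = sepBefore (map reg (replicate m 0) ++ [ hash ])
  W : ℕ → BraidWord
  W m = valueBraid (tail m)
  X Y : BraidWord
  X = keyBraid startKey
  Y = valueBraid (sep ∷ tape (st 0) ∷ [])
  e : (X ++ Y) ++ W n ≡ tileBraid (firstTile n)
  e = ≡.trans (++-assoc X Y (W n)) (cong (X ++_) (≡.sym (valueBraid-++ (sep ∷ tape (st 0) ∷ []) (tail n))))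

instanceF : PRF 1
instanceF = consF firstWordF (projF zero)

instanceF-⇓ : ∀ n → instanceF ⟦ n ∷ [] ⟧⇓ suc (pair (encodeWord (tileBraid (firstTile n))) n)
instanceF-⇓ n = consF-⇓ (firstWordF-⇓ n) ev-proj

bounded-replicate : ∀ n {N} → 1 ≤ N → All (_< N) (replicate n 0)
bounded-replicate zero p = []
bounded-replicate (suc n) p = p ∷ bounded-replicate n p

replicate-⟨⟩ : ∀ n → replicate n 0 ⟨ 0 ⟩ ≡ n
replicate-⟨⟩ zero = ≡.refl
replicate-⟨⟩ (suc n) = cong suc (replicate-⟨⟩ n)

st-~ : ∀ {q r u v} → (st q ∷ u) ~ (st r ∷ v) → q ≡ r
st-~ (_ ∷ _) = ≡.refl

-- The machine runs P and then inspects register 1: it erases the store and halts if the register is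
-- positive, and gets stuck if it is zero.
module Machine (P : Prog) where

  T : ℕ
  T = size P + 0

  C : Code
  -- State `T` tests register 1: `2 + T` starts erasing and exits to `4 + T`, the state of `final`,
  -- while `3 + T` has no instruction.
  C = code P 0 T ++ test 1 T (3 + T) ++ [ 2 + T , walk (λ _ → st (2 + T) ∷ []) (4 + T) ]

  N : ℕ
  -- The 1 admits register 0, which holds the input.
  N = incBound P ⊔ 1

  final : List Sym
  final = st (4 + T) ∷ hash ∷ []

  C-block : Block 0 (3 + T) C
  C-block = ++-block (code-block P 0 T) (++-block (test-block 1 T (3 + T)) (single-block (2 + T) _))

  no-state : ∀ {q} → 3 + T ≤ q → ∀ {i} → ¬ (q , i) ∈ C
  no-state ≤q m = <⇒≱ (proj₂ (Block.within C-block m)) ≤q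

  system : ℕ → QueueSystem
  system n = record
    { Sym = Sym
    ; Rule = Rule N C
    ; init = initial n
    ; final = final
    ; lhs-nonempty = Rule-lhs-nonempty
    ; rhs-nonempty = Rule-rhs-nonempty
    ; init-nonempty = λ ()
    ; final-nonempty = λ ()
    ; deterministic = Rule-deterministic (Block.functional C-block)
    ; final-irreducible = λ ρ f~u → no-state (n≤1+n _) (proj₂ (Rule-state ρ (~-sym f~u)))
    }

  open Queue (Rule N C)
  open Simulation N C

  run-P : ∀ {n M} → Exec P (replicate n 0) M → initial n ⇝* conf T M [] × All (_< N) M
  run-P {n} ex = simulate ex ∈-++⁺ˡ (m≤m⊔n (incBound P) 1) (bounded-replicate n (m≤n⊔m (incBound P) 1))

  test⊆C : ∀ {x} → x ∈ test 1 T (3 + T) → x ∈ C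
  test⊆C = ∈-++⁺ʳ (code P 0 T) ∘ ∈-++⁺ˡ

  erase∈C : (2 + T , walk (λ _ → st (2 + T) ∷ []) (4 + T)) ∈ C
  erase∈C = ∈-++⁺ʳ (code P 0 T) (∈-++⁺ʳ (test 1 T (3 + T)) (here ≡.refl))

  erase : ∀ {M} → All (_< N) M → conf (2 + T) M [] ⇝* final
  erase [] = return erase∈C []
  erase (a<N ∷ b) = ⇝*-trans (rewrite-front (walk-reg erase∈C a<N) (body-copyable b [])) (erase b)

  accept : ∀ {n M v} → Exec P (replicate n 0) M → M ⟨ 1 ⟩ ≡ suc v → initial n ⇝* final
  accept {M = M} ex M⟨1⟩ with run-P ex | split 1 M M⟨1⟩
  ... | r , b | A , D , ≡.refl , A⟨1⟩ with ++⁻ A b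
  ...   | bA , _ ∷ bD = ⇝*-trans r (⇝*-trans (test-suc A D test⊆C b A⟨1⟩) (erase (++⁺ bA bD)))

  reject : ∀ {n M} → Exec P (replicate n 0) M → M ⟨ 1 ⟩ ≡ 0 → Dominoes.Dead (system n) (initial n)
  reject {n} ex M⟨1⟩ =
    let r , b = run-P ex
    in ⇝*-Dead (⇝*-trans r (test-zero test⊆C b M⟨1⟩))
         -- State `3 + T` heads no rule and differs from the state of `final`.
         (stuck (λ ρ c → no-state ≤-refl (proj₂ (Rule-state ρ c))) (1+n≢n ∘ st-~))
    where open Dominoes (system n) using (⇝*-Dead; stuck)

  ruleTiles : List Sym × List Sym → List (List (Ext Sym) × List (Ext Sym))
  ruleTiles (u , v) = (map tape u , sepBefore v) ∷ (map tape u , sepAfter u) ∷ []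

  baseTiles : List (List (Ext Sym) × List (Ext Sym))
  baseTiles = (startKey , [ sep ]) ∷ (map tape final , sep ∷ end ∷ []) ∷
              (map tape final , sepAfter final ++ end ∷ []) ∷ concatMap ruleTiles (rules N C)

  tiles : ℕ → List (List (Ext Sym) × List (Ext Sym))
  tiles n = firstTile n ∷ baseTiles

  module _ (n : ℕ) where
    open Dominoes (system n)

    ∈⇒IsTile : ∀ {x} → x ∈ tiles n → IsTile x
    ∈⇒IsTile (here ≡.refl) = left startD
    ∈⇒IsTile (there (here ≡.refl)) = right startD
    ∈⇒IsTile (there (there (here ≡.refl))) = left finalD
    ∈⇒IsTile (there (there (there (here ≡.refl)))) = right finalD
    ∈⇒IsTile (there (there (there (there m)))) with find (∈-concatMap⁻ ruleTiles {xs = rules N C} m)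
    ... | _ , ρ , here ≡.refl = left (ruleD (∈⇒Rule ρ))
    ... | _ , ρ , there (here ≡.refl) = right (ruleD (∈⇒Rule ρ))

    IsTile⇒∈ : ∀ {x} → IsTile x → x ∈ tiles n
    IsTile⇒∈ (left startD) = here ≡.refl
    IsTile⇒∈ (right startD) = there (here ≡.refl)
    IsTile⇒∈ (left finalD) = there (there (here ≡.refl))
    IsTile⇒∈ (right finalD) = there (there (there (here ≡.refl)))
    IsTile⇒∈ (left (ruleD ρ)) =
      there (there (there (there (∈-concatMap⁺ ruleTiles (lose (Rule⇒∈ ρ) (here ≡.refl))))))
    IsTile⇒∈ (right (ruleD ρ)) =
      there (there (there (there (∈-concatMap⁺ ruleTiles (lose (Rule⇒∈ ρ) (there (here ≡.refl)))))))

  braids : ℕ → List BraidWord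
  braids n = map tileBraid (tiles n)

-- Freeness of the instances

module _ {A : Set} (f : A → BraidWord) where

  lookups : ∀ xs (s : List (Fin (length (map f xs)))) →
            ∃ λ ys → All (_∈ xs) ys × map (lookup (map f xs)) s ≡ map f ys
  lookups xs [] = [] , [] , ≡.refl
  lookups xs (i ∷ s) =
    let y , y∈ , e = ∈-map⁻ f (∈-lookup {xs = map f xs} i)
        ys , ys∈ , es = lookups xs s
    in y ∷ ys , y∈ ∷ ys∈ , cong₂ _∷_ e es

  indices : ∀ {xs ys} → All (_∈ xs) ys → ∃ λ (s : List (Fin (length (map f xs)))) →
            map (lookup (map f xs)) s ≡ map f ys
  indices [] = [] , ≡.refl
  indices (y∈ ∷ ys∈) =
    let s , e = indices ys∈
        y∈′ = ∈-map⁺ f y∈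
    in index y∈′ ∷ s , cong₂ _∷_ (≡.sym (lookup-index y∈′)) e

map-≡⇒Pointwise : ∀ {A : Set} (f : A → BraidWord) s t → map f s ≡ map f t → Pointwise (λ i j → f i ≈B f j) s t
map-≡⇒Pointwise f [] [] e = []
map-≡⇒Pointwise f (i ∷ s) (j ∷ t) e =
  let e₁ , e₂ = ∷-injective e in subst (f i ≈B_) e₁ refl ∷ map-≡⇒Pointwise f s t e₂

module _ (P : Prog) (n : ℕ) where
  open Machine P
  open Dominoes (system n)

  Dead⇒IsFree : Dead (initial n) → IsFree (braids n)
  Dead⇒IsFree d s t e
    with ss , ss∈ , es ← lookups tileBraid (tiles n) (toList s)
       | tt , tt∈ , et ← lookups tileBraid (tiles n) (toList t) =
    map-≡⇒Pointwise _ (toList s) (toList t) (≡.trans es (≡.trans (cong (map tileBraid) ss≡tt) (≡.sym et)))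
    where
    products : tileBraid (keys ss , vals ss) ≈B tileBraid (keys tt , vals tt)
    products = sym (prod-tileBraid ss) ⟫ subst₂ _≈B_ (cong prod es) (cong prod et) e ⟫ prod-tileBraid tt
    ss≡tt : ss ≡ tt
    ss≡tt = Dead⇒unique d (All.map (∈⇒IsTile n) ss∈) (All.map (∈⇒IsTile n) tt∈)
      (cong proj₁ (tileBraid-injective products)) (cong proj₂ (tileBraid-injective products))

  -- Prefixing the two sides of the match with the two start tiles, at indices `zero` and
  -- `suc zero`, gives equal products whose first factors differ.
  ⇝*⇒¬IsFree : initial n ⇝* final → ¬ IsFree (braids n)
  ⇝*⇒¬IsFree r free
    with ss , tt , S , T , ke , ve ← ⇝*-match r
    with s , es ← indices tileBraid (All.map (IsTile⇒∈ n) S)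
       | t , et ← indices tileBraid (All.map (IsTile⇒∈ n) T) = start-differs (free (zero ∷ s) (suc zero ∷ t) collide)
    where
    collide : evalSeq (braids n) (zero ∷ s) ≈B evalSeq (braids n) (suc zero ∷ t)
    collide = subst₂ _≈B_ (≡.sym (cong (λ w → prod (tileBraid (firstTile n) ∷ w)) es))
                          (≡.sym (cong (λ w → prod (tileBraid (startKey , [ sep ]) ∷ w)) et))
      (prod-tileBraid (firstTile n ∷ ss) ⟫
       subst₂ (λ k v → tileBraid (keys (firstTile n ∷ ss) , vals (firstTile n ∷ ss)) ≈B tileBraid (k , v))
         (cong (start ∷_) ke) ve refl ⟫
       sym (prod-tileBraid ((startKey , [ sep ]) ∷ tt)))
    start-differs : ¬ Pointwise (λ i j → lookup (braids n) i ≈B lookup (braids n) j) (zero ∷ s) (suc zero ∷ t)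
    start-differs (e ∷ _) with cong proj₂ (tileBraid-injective e)
    ... | ()

-- The input n is the code of all of the instance but its first braid, so that n determines the code
-- of the whole instance.
not-decided : ∀ {p} P → (∀ {n y} → p ⟦ suc (pair (encodeWord (tileBraid (firstTile n))) n) ∷ [] ⟧⇓ y →
                                   Computes P 1 y (replicate n 0)) →
              ¬ DecidesFreeness p
not-decided {p} P simulates decides = diagonal _ ≡.refl
  where
  open Machine P
  -- The code number stays a variable tied by an equation, so that it is never evaluated.
  diagonal : ∀ n → encodeSet (map tileBraid baseTiles) ≢ n
  diagonal n e =
    let free⇒1 , ¬free⇒0 = decides (braids n)
        -- If the instance is free, `p` answers 1 and the machine accepts, which refutes freeness.
        -- So `p` answers 0, the machine gets stuck and the instance is free after all.
        not-free = λ free → let _ , exec , result , _ = run (free⇒1 free)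
                            in ⇝*⇒¬IsFree P n (accept exec result) free
        _ , exec , result , _ = run (¬free⇒0 not-free)
    in not-free (Dead⇒IsFree P n (reject exec result))
    where
    run : ∀ {y} → p ⟦ encodeSet (braids n) ∷ [] ⟧⇓ y → Computes P 1 y (replicate n 0)
    run d = simulates (subst (λ m → p ⟦ suc (pair (encodeWord (tileBraid (firstTile n))) m) ∷ [] ⟧⇓ _) e d)

theorem4 : ¬ Σ (PRF 1) DecidesFreeness
theorem4 (p , decides) = not-decided (compile q (0 ∷ []) 1) simulates decides
  where
  -- From n, the code of the instance with first braid for n and remaining braids of code n is
  -- formed and given to `p`. Input is in register 0, output in register 1.
  q : PRF 1
  q = compF p (instanceF ∷ [])
  simulates : ∀ {n y} → p ⟦ suc (pair (encodeWord (tileBraid (firstTile n))) n) ∷ [] ⟧⇓ y →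
              Computes (compile q (0 ∷ []) 1) 1 y (replicate n 0)
  simulates {n} d =
    correct q (ev-comp (instanceF-⇓ n ∷ []) d) (replicate n 0) (s≤s z≤n ∷ []) (cong (_∷ []) (replicate-⟨⟩ n))
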